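{- Let $\Gamma$ be a finite connected 4-regular graph (loops and multiple edges allowed) and let $T$ be a transition system of $\Gamma$. Let $w$ be an Euler tour of $\Gamma$ orthogonal to $T$ and let $G_w$ be the associated bicoloured graph. Then $T$ admits no orthogonal cycle decomposition if and only if the parity class $[G_w]$ is pure.
   Context: At each vertex $u$ of $\Gamma$ there are four edge-ends (a loop contributes two). A transition system $T$ of $\Gamma$ assigns to every vertex $u$ a partition of its four edge-ends into two pairs (the transitions of $T$ at $u$). A cycle is a connected 2-regular (sub)graph (a loop is a 1-cycle, two parallel edges form a 2-cycle); a cycle decomposition of $\Gamma$ is a partition of $E(\Gamma)$ into cycles; at each vertex $u$ it pairs the edge-ends at $u$ belonging to the same cycle consecutively. An Euler tour (closed trail using every edge once) passes twice through each vertex and each passage pairs the entering and leaving edge-ends. A cycle decomposition or Euler tour is orthogonal to $T$ if none of the pairs it induces is a pair of $T$. (Euler tours orthogonal to $T$ exist.) Given such a tour $w$, $G_w$ is the bicoloured simple graph with vertex set $V(\Gamma)$, in which distinct $u,v$ are adjacent iff their occurrences interlace in the cyclic sequence of vertices of $w$ (i.e. the cyclic sequence reads $\ldots u\ldots v\ldots u\ldots v\ldots$), and, fixing a direction of traversal of $w$, $u$ is black iff the entering edge-ends of the two passages of $w$ through $u$ lie in the same pair of $T$, white otherwise. Bicoloured local complementation: for a bicoloured graph $G$ and $u\in V(G)$, $Gu$ has edge set $E(G)\triangle\{[x,y]:x\ne y\in N_G(u)\}$ and the same colouring if $u$ is black, while if $u$ is white the colours of all vertices of $N_G(u)$ are reversed;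 $Gu_1\cdots u_k=(\cdots(Gu_1)\cdots)u_k$. $W^\circ(G)$ is the smallest set of words containing the empty word such that $s\in W^\circ(G)$, $u$ white in $Gs$ implies $su\in W^\circ(G)$, and $s\in W^\circ(G)$, $u,v$ adjacent black in $Gs$ implies $suvu,svuv\in W^\circ(G)$. $[G]=\{Gs:s\in W^\circ(G)\}$. A black anticlique is a maximal independent set consisting of black vertices; $[G]$ is pure if no member has a black anticlique. -}

module Defs where

open import Data.Nat using (ℕ; zero; suc)
open import Data.Fin using (Fin; zero; suc; _<_; _≟_)
open import Data.Product using (Σ; ∃; _×_; _,_; proj₁; proj₂)
open import Data.Sum using (_⊎_)
open import Data.Bool using (Bool; true; false; _∧_; _xor_; not; if_then_else_)
open import Data.Maybe using (Maybe; just; nothing; maybe)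
import Data.Maybe as Maybe
open import Data.List using (List; []; _∷_; _++_; length; lookup; foldl)
open import Function using (id)
open import Relation.Nullary using (¬_)
open import Relation.Nullary.Decidable using (⌊_⌋)
open import Relation.Binary.PropositionalEquality using (_≡_; _≢_)
open import Function.Bundles using (_⇔_)

sucMaybe : ∀ {k} → Fin (suc k) → Maybe (Fin (suc k))
sucMaybe {zero} zero = nothing
sucMaybe {suc k} zero = just (suc zero)
sucMaybe {suc k} (suc i) = Maybe.map suc (sucMaybe i)

next : ∀ {k} → Fin (suc k) → Fin (suc k)
next i = maybe id zero (sucMaybe i)

-- 4-regular multigraphs (loops / multiple edges allowed) on vertex set
-- Fin n, given by their edge-ends: vertex u has the four edge-ends
-- (u , 0..3); an edge is a pair {h , σ h} for a fixed-point-free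
-- involution σ on edge-ends (a loop at u pairs two ends at u).

HE : ℕ → Set
HE n = Fin n × Fin 4

vert : ∀ {n} → HE n → Fin n
vert = proj₁

idx : ∀ {n} → HE n → Fin 4
idx = proj₂

record Graph4 (n : ℕ) : Set where
  field
    σ      : HE n → HE n
    σ-inv  : ∀ h → σ (σ h) ≡ h
    σ-nfix : ∀ h → σ h ≢ h
open Graph4 public

data Reach {n : ℕ} (Γ : Graph4 n) (u : Fin n) : Fin n → Set where
  here  : Reach Γ u u
  along : ∀ h → Reach Γ u (vert h) → Reach Γ u (vert (σ Γ h))

Connected : ∀ {n} → Graph4 n → Set
Connected {n} Γ = ∀ (u v : Fin n) → Reach Γ u v

-- Transition systems: at each vertex, a partition of its four edge-ends
-- into two pairs, i.e. a fixed-point-free involution of Fin 4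
-- (i and pair u i form a transition at u).

record TransSys (n : ℕ) : Set where
  field
    pair      : Fin n → Fin 4 → Fin 4
    pair-inv  : ∀ u i → pair u (pair u i) ≡ i
    pair-nfix : ∀ u i → pair u i ≢ i
open TransSys public

-- Closed trails: a cyclic sequence of departing edge-ends d 0 .. d (len-1);
-- step k traverses the edge {d k , σ (d k)} and arrives at σ (d k); the
-- next step departs from the same vertex via a different edge-end.

record ClosedTrail {n : ℕ} (Γ : Graph4 n) : Set where
  field
    len′   : ℕ
    d      : Fin (suc len′) → HE n
    step   : ∀ k → vert (d (next k)) ≡ vert (σ Γ (d k))
    noBack : ∀ k → d (next k) ≢ σ Γ (d k)
open ClosedTrail public

endAt : ∀ {n} {Γ : Graph4 n} (w : ClosedTrail Γ) → Fin (suc (len′ w)) × Bool → HE n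
endAt {Γ = Γ} w (k , false) = d w k
endAt {Γ = Γ} w (k , true)  = σ Γ (d w k)

EulerTour : ∀ {n} {Γ : Graph4 n} → ClosedTrail Γ → Set
EulerTour {n} w =
  (∀ p q → endAt w p ≡ endAt w q → p ≡ q) × (∀ (h : HE n) → ∃ λ p → endAt w p ≡ h)

-- The passage after step k pairs the entering end σ (d k) with the leaving
-- end d (next k) at the vertex vert (σ (d k)).  Orthogonal to T: no such
-- pair is a transition of T.
OrthTrail : ∀ {n} {Γ : Graph4 n} → TransSys n → ClosedTrail Γ → Set
OrthTrail {Γ = Γ} T w =
  ∀ k → pair T (vert (σ Γ (d w k))) (idx (σ Γ (d w k))) ≢ idx (d w (next k))

-- Cycles: closed trails through pairwise distinct vertices (a loop is a
-- 1-cycle, two parallel edges a 2-cycle).  Cycle decompositions: lists of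
-- cycles in which every edge-end (hence every edge) occurs exactly once.

record Cycle {n : ℕ} (Γ : Graph4 n) : Set where
  field
    trail    : ClosedTrail Γ
    distinct : ∀ j k → vert (d trail j) ≡ vert (d trail k) → j ≡ k
open Cycle public

Pos : ∀ {n} {Γ : Graph4 n} → List (Cycle Γ) → Set
Pos cs = Σ (Fin (length cs)) λ i → Fin (suc (len′ (trail (lookup cs i)))) × Bool

endAtD : ∀ {n} {Γ : Graph4 n} (cs : List (Cycle Γ)) → Pos cs → HE n
endAtD cs (i , p) = endAt (trail (lookup cs i)) p

IsCycleDecomposition : ∀ {n} {Γ : Graph4 n} → List (Cycle Γ) → Set
IsCycleDecomposition {n} cs =
  (∀ p q → endAtD cs p ≡ endAtD cs q → p ≡ q) × (∀ (h : HE n) → ∃ λ p → endAtD cs p ≡ h)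

OrthDecomp : ∀ {n} {Γ : Graph4 n} → TransSys n → List (Cycle Γ) → Set
OrthDecomp T cs = ∀ (i : Fin (length cs)) → OrthTrail T (trail (lookup cs i))

HasOrthCycleDecomposition : ∀ {n} → Graph4 n → TransSys n → Set
HasOrthCycleDecomposition Γ T =
  Σ (List (Cycle Γ)) λ cs → IsCycleDecomposition cs × OrthDecomp T cs

record BGraph (n : ℕ) : Set where
  field
    adj   : Fin n → Fin n → Bool
    black : Fin n → Bool
open BGraph public

Interlace : ∀ {n} {Γ : Graph4 n} → ClosedTrail Γ → Fin n → Fin n → Set
Interlace w u v =
  ∃ λ i → ∃ λ j → ∃ λ k → ∃ λ l → i < j × j < k × k < l ×
    ( (vert (d w i) ≡ u × vert (d w j) ≡ v × vert (d w k) ≡ u × vert (d w l) ≡ v)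
    ⊎ (vert (d w i) ≡ v × vert (d w j) ≡ u × vert (d w k) ≡ v × vert (d w l) ≡ u))

BlackIn : ∀ {n} {Γ : Graph4 n} → TransSys n → ClosedTrail Γ → Fin n → Set
BlackIn {Γ = Γ} T w u =
  ∃ λ a → ∃ λ b → a ≢ b × vert (σ Γ (d w a)) ≡ u × vert (σ Γ (d w b)) ≡ u ×
    pair T u (idx (σ Γ (d w a))) ≡ idx (σ Γ (d w b))

IsGw : ∀ {n} {Γ : Graph4 n} → TransSys n → ClosedTrail Γ → BGraph n → Set
IsGw {n} T w G =
  (∀ (u v : Fin n) → (adj G u v ≡ true) ⇔ (u ≢ v × Interlace w u v)) ×
  (∀ (u : Fin n) → (black G u ≡ true) ⇔ BlackIn T w u)

lc : ∀ {n} → BGraph n → Fin n → BGraph n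
lc G u = record
  { adj   = λ x y → adj G x y xor (adj G u x ∧ adj G u y ∧ not ⌊ x ≟ y ⌋)
  ; black = λ x → if black G u then black G x else (black G x xor adj G u x)
  }

apply : ∀ {n} → BGraph n → List (Fin n) → BGraph n
apply = foldl lc

data W {n : ℕ} (G : BGraph n) : List (Fin n) → Set where
  empty : W G []
  white : ∀ {s u} → W G s → black (apply G s) u ≡ false → W G (s ++ u ∷ [])
  pivotuvu : ∀ {s u v} → W G s → adj (apply G s) u v ≡ true →
             black (apply G s) u ≡ true → black (apply G s) v ≡ true →
             W G (s ++ u ∷ v ∷ u ∷ [])
  pivotvuv : ∀ {s u v} → W G s → adj (apply G s) u v ≡ true →
             black (apply G s) u ≡ true → black (apply G s) v ≡ true →
             W G (s ++ v ∷ u ∷ v ∷ [])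

BlackAnticlique : ∀ {n} → BGraph n → (Fin n → Bool) → Set
BlackAnticlique {n} G S =
  (∀ x → S x ≡ true → black G x ≡ true) ×
  (∀ x y → S x ≡ true → S y ≡ true → x ≢ y → adj G x y ≡ false) ×
  (∀ z → S z ≡ false → ∃ λ x → S x ≡ true × adj G z x ≡ true)

Pure : ∀ {n} → BGraph n → Set
Pure {n} G = ∀ (s : List (Fin n)) → W G s → ¬ (Σ (Fin n → Bool) λ S → BlackAnticlique (apply G s) S)

{-# OPTIONS --safe #-}
module Submission where

-- An Euler tour is a list of darts; its vertex word passes every vertex twice.  Switching the
-- transitions of the tour at a white vertex u (reversing the segment between the two passages of
-- u), or at two interlaced black vertices (exchanging two segments), gives again an orthogonal Euler
-- tour, and the interlace graph changes exactly as the steps of W prescribe.  Switching at a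
-- non-interlacing set S of black vertices cuts the tour into closed trails, and a vertex is passed
-- twice by one of them exactly when it lies outside S and interlaces with no vertex of S; so the
-- closed trails are cycles precisely when S is a black anticlique.  Conversely a cycle decomposition
-- orthogonal to T arises from the tour by switching at some set S, and as long as S contains a
-- white vertex or two adjacent black vertices a step of W makes S smaller.

open import Defs
open import Data.Nat using (ℕ; zero; suc; _+_; _≤_; _<_; z≤n; s≤s; s≤s⁻¹)
open import Data.Nat.Properties
  using (+-assoc; +-comm; +-suc; +-identityʳ; suc-injective; m+n≡0⇒m≡0; m+n≡0⇒n≡0; +-cancelˡ-≡;
    ≤-refl; ≤-trans; ≤-reflexive; ≤-antisym; <-irrefl; n≤0⇒n≡0; m≤m+n; m≤n+m; +-mono-≤; +-mono-≤-<;
    +-monoʳ-≤)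
import Data.Nat.Solver as ℕ-Solver
open import Data.Fin as Fin using (Fin; zero; suc)
open import Data.Fin.Properties using (injective⇒≤; any?)
import Data.Fin.Properties as Fin
open import Data.Bool as Bool using (Bool; true; false; _∧_; _∨_; _xor_; not; if_then_else_)
open import Data.Bool.Properties
  using (∧-zeroʳ; ∧-identityʳ; ∨-zeroʳ; xor-identityʳ; xor-comm; xor-assoc; not-involutive; ¬-not)
open import Data.Bool.Solver using (module xor-∧-Solver)
open import Data.Maybe as Maybe using (just; nothing; maybe)
import Data.Vec as Vec
import Data.Vec.Relation.Unary.All as VecAll
import Data.Vec.Relation.Unary.AllPairs as VecAllPairs
import Data.Vec.Relation.Unary.Unique.Propositional as VecUnique
import Data.Vec.Relation.Unary.Unique.Propositional.Properties as VecUnique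
open import Data.List
  using (List; []; _∷_; _++_; map; reverse; tabulate; concat; lookup; filter; allFin; length)
open import Data.List.Properties
  using (map-++; unfold-reverse; ++-assoc; ++-identityʳ; concat-++; foldl-++)
open import Data.List.Membership.Propositional using (_∈_)
open import Data.List.Membership.Propositional.Properties
  using (∈-++⁺ˡ; ∈-++⁺ʳ; ∈-++⁻; ∈-map⁺; ∈-tabulate⁺; ∈-filter⁺; ∈-filter⁻; ∈-allFin; ∈-lookup)
import Data.List.Relation.Unary.All as All
open import Data.List.Relation.Unary.Any as Any using (here; there)
open import Data.List.Relation.Unary.Any.Properties using (lookup-index)
open import Data.List.Relation.Unary.AllPairs using ([]; _∷_)
open import Data.List.Relation.Unary.Unique.Propositional using (Unique)
open import Data.List.Relation.Unary.Unique.Propositional.Properties using (filter⁺; allFin⁺)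
open import Data.List.Relation.Binary.Sublist.Propositional using (_⊆_; []; _∷_; _∷ʳ_; minimum)
open import Data.List.Relation.Binary.Sublist.Propositional.Properties using (++⁺ˡ; map⁺)
open import Data.Product using (Σ; ∃; _×_; _,_; proj₁; proj₂)
open import Data.Product.Properties using (≡-dec)
open import Data.Sum using (_⊎_; inj₁; inj₂; [_,_]′)
open import Data.Unit using (⊤; tt)
open import Data.Empty using (⊥; ⊥-elim)
open import Function using (_∘_; case_of_)
open import Function.Bundles using (_⇔_; mk⇔; Equivalence)
open import Relation.Nullary using (¬_; Dec; yes; no)
open import Relation.Nullary.Decidable using (⌊_⌋; _×-dec_)
open import Relation.Binary using (DecidableEquality)
open import Relation.Binary.PropositionalEquality

-- The four edge-ends at a vertex have three pairings. One of them is given by T, and the other two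
-- are interchanged by composing with `T̂`. Two structures orthogonal to T therefore differ only in
-- a set of vertices. This is why tours and decompositions alike are first turned into an involution
-- τ of the edge-ends: a decomposition need not be compared with a tour trail by trail, only through
-- the set where the two involutions disagree. Interlacement and colour are recorded as parities: of
-- the occurrences of x followed by one of y, and of the departures along an end and along its
-- T-partner. Both definitions are insensitive to where the cyclic word is cut open. Reversing or
-- exchanging segments then changes them by polynomial identities over the field with two elements,
-- which a ring solver checks, and no case distinction on the relative position of four passages is
-- needed. `Represents` is the invariant that every step of W preserves.

odd : ℕ → Bool
odd zero    = false
odd (suc n) = not (odd n)

odd-+ : ∀ m n → odd (m + n) ≡ odd m xor odd n
odd-+ zero    n = refl
odd-+ (suc m) n rewrite odd-+ m n with odd m
... | true  = not-involutive _
... | false = refl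

b2n : Bool → ℕ
b2n true  = 1
b2n false = 0

odd-b2n : ∀ b → odd (b2n b) ≡ b
odd-b2n true  = refl
odd-b2n false = refl

-- Common induction step of `inter-comm` and `inter-reverse`, with e and f telling whether the new
-- letter is x or y. The two sides differ exactly by `e ∧ f`, which vanishes for distinct letters.
comm-step : ∀ e f i p q → e ∧ f ≡ false →
  (f ∧ p) xor (i xor (p ∧ q)) ≡ ((e ∧ q) xor i) xor ((e xor p) ∧ (f xor q))
comm-step false f i p q _ = solve 4 (λ f i p q → (f :* p) :+ (i :+ (p :* q)) := i :+ (p :* (f :+ q))) refl f i p q
  where open xor-∧-Solver
comm-step true false i p q _ = solve 3 (λ i p q → i :+ (p :* q) := (q :+ i) :+ ((con true :+ p) :* q)) refl i p q
  where open xor-∧-Solver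

-- Occurrence counts, parities and interlacement in words.

module Counting {A : Set} (_≟_ : DecidableEquality A) where

  eq : A → A → Bool
  eq x y = ⌊ x ≟ y ⌋

  eq-true : ∀ {x y} → x ≡ y → eq x y ≡ true
  eq-true {x} {y} e with x ≟ y
  ... | yes _ = refl
  ... | no ¬e = ⊥-elim (¬e e)

  eq-false : ∀ {x y} → x ≢ y → eq x y ≡ false
  eq-false {x} {y} ne with x ≟ y
  ... | yes e = ⊥-elim (ne e)
  ... | no _  = refl

  eq⇒≡ : ∀ {x y} → eq x y ≡ true → x ≡ y
  eq⇒≡ {x} {y} e with x ≟ y
  ... | yes p = p

  eq⇒≢ : ∀ {x y} → eq x y ≡ false → x ≢ y
  eq⇒≢ {x} {y} e with x ≟ y
  ... | no ne = ne

  cnt : A → List A → ℕ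
  cnt x []      = 0
  cnt x (y ∷ L) = b2n (eq x y) + cnt x L

  par : A → List A → Bool
  par x L = odd (cnt x L)

  cnt-++ : ∀ x K L → cnt x (K ++ L) ≡ cnt x K + cnt x L
  cnt-++ x []      L = refl
  cnt-++ x (y ∷ K) L rewrite cnt-++ x K L = sym (+-assoc (b2n (eq x y)) _ _)

  cnt-here : ∀ {x y} L → x ≡ y → cnt x (y ∷ L) ≡ suc (cnt x L)
  cnt-here L e rewrite eq-true e = refl

  cnt-there : ∀ {x y} L → x ≢ y → cnt x (y ∷ L) ≡ cnt x L
  cnt-there L ne rewrite eq-false ne = refl

  cnt-reverse : ∀ x L → cnt x (reverse L) ≡ cnt x L
  cnt-reverse x []      = refl
  cnt-reverse x (y ∷ L)
    rewrite unfold-reverse y L | cnt-++ x (reverse L) (y ∷ []) | cnt-reverse x L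
          | +-identityʳ (b2n (eq x y)) = +-comm (cnt x L) _

  par-++ : ∀ x K L → par x (K ++ L) ≡ par x K xor par x L
  par-++ x K L rewrite cnt-++ x K L = odd-+ (cnt x K) _

  par-∷ : ∀ x y L → par x (y ∷ L) ≡ eq x y xor par x L
  par-∷ x y L = trans (odd-+ (b2n (eq x y)) _) (cong (_xor par x L) (odd-b2n (eq x y)))

  par-reverse : ∀ x L → par x (reverse L) ≡ par x L
  par-reverse x L = cong odd (cnt-reverse x L)

  cnt>0⇒∈ : ∀ {x m} L → cnt x L ≡ suc m → x ∈ L
  cnt>0⇒∈ {x} (y ∷ L) e with x ≟ y
  ... | yes p = here p
  ... | no _  = there (cnt>0⇒∈ L e)

  ∈⇒cnt>0 : ∀ {x L} → x ∈ L → ∃ λ m → cnt x L ≡ suc m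
  ∈⇒cnt>0 {x} {y ∷ L} (here p)  = _ , cnt-here L p
  ∈⇒cnt>0 {x} {y ∷ L} (there i) with ∈⇒cnt>0 i
  ... | m , e rewrite e = _ , +-suc (b2n (eq x y)) m

  cnt≡0⇒∉ : ∀ {x L} → cnt x L ≡ 0 → ¬ (x ∈ L)
  cnt≡0⇒∉ e i with ∈⇒cnt>0 i
  ... | m , e′ with trans (sym e) e′
  ... | ()

  cnt-repeated : ∀ x P A Q → 2 ≤ cnt x (P ++ (x ∷ A) ++ x ∷ Q)
  cnt-repeated x P A Q rewrite cnt-++ x P ((x ∷ A) ++ x ∷ Q) | cnt-++ x (x ∷ A) (x ∷ Q) | eq-true (refl {x = x}) =
    ≤-trans (+-mono-≤ {1} {_} {1} (s≤s z≤n) (s≤s z≤n)) (m≤n+m _ (cnt x P))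

  cnt-concat : ∀ x {K} Ks → K ∈ Ks → cnt x K ≤ cnt x (concat Ks)
  cnt-concat x (K ∷ Ks) i rewrite cnt-++ x K (concat Ks) with i
  ... | here refl = m≤m+n _ _
  ... | there j   = ≤-trans (cnt-concat x Ks j) (m≤n+m _ _)

  cnt-map : ∀ {f : A → A} → (∀ {x y} → f x ≡ f y → x ≡ y) → ∀ x L → cnt (f x) (map f L) ≡ cnt x L
  cnt-map         inj x []      = refl
  cnt-map {f = f} inj x (y ∷ L) with x ≟ y
  ... | yes e rewrite eq-true (cong f e)   = cong suc (cnt-map inj x L)
  ... | no ne rewrite eq-false (ne ∘ inj) = cnt-map inj x L

  -- The parity of the number of occurrences of x followed by an occurrence of y.  In a word
  -- containing x and y twice each it is odd exactly when x and y interlace.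
  inter : A → A → List A → Bool
  inter x y []      = false
  inter x y (z ∷ L) = (eq x z ∧ par y L) xor inter x y L

  -- The product is the contribution of the pairs with x in K and y in L.
  inter-++ : ∀ x y K L → inter x y (K ++ L) ≡ (inter x y K xor inter x y L) xor (par x K ∧ par y L)
  inter-++ x y []      L = sym (xor-identityʳ _)
  inter-++ x y (z ∷ K) L rewrite inter-++ x y K L | par-++ y K L | par-∷ x z K =
    solve 6 (λ e k l i j p → (e :* (k :+ l)) :+ ((i :+ j) :+ (p :* l))
                          := (((e :* k) :+ i) :+ j) :+ ((e :+ p) :* l)) refl
      (eq x z) (par y K) (par y L) (inter x y K) (inter x y L) (par x K)
    where open xor-∧-Solver

  inter-noˡ : ∀ {x} y L → cnt x L ≡ 0 → inter x y L ≡ false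
  inter-noˡ y []      e = refl
  inter-noˡ {x} y (z ∷ L) e with eq x z | e
  ... | false | e′ = inter-noˡ y L e′

  inter-noʳ : ∀ x {y} L → cnt y L ≡ 0 → inter x y L ≡ false
  inter-noʳ x []      e = refl
  inter-noʳ x {y} (z ∷ L) e
    rewrite m+n≡0⇒n≡0 (b2n (eq y z)) e | ∧-zeroʳ (eq x z) = inter-noʳ x L (m+n≡0⇒n≡0 (b2n (eq y z)) e)

  eq-disjoint : ∀ {x y} z → x ≢ y → eq x z ∧ eq y z ≡ false
  eq-disjoint {x} {y} z ne with x ≟ z | y ≟ z
  ... | yes p | yes q = ⊥-elim (ne (trans p (sym q)))
  ... | yes _ | no _  = refl
  ... | no _  | _     = refl

  -- Every occurrence of x together with one of y is ordered in exactly one way, so both orders add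
  -- up to the product of the two counts.
  inter-comm : ∀ {x y} L → x ≢ y → inter y x L ≡ inter x y L xor (par x L ∧ par y L)
  inter-comm []      ne = refl
  inter-comm {x} {y} (z ∷ L) ne rewrite inter-comm L ne | par-∷ x z L | par-∷ y z L =
    comm-step (eq x z) (eq y z) (inter x y L) (par x L) (par y L) (eq-disjoint z ne)

  -- Reversal turns "x before y" into "y before x", so the change is the same as in `inter-comm`.
  inter-reverse : ∀ {x y} L → x ≢ y → inter x y (reverse L) ≡ inter x y L xor (par x L ∧ par y L)
  inter-reverse []      ne = refl
  inter-reverse {x} {y} (z ∷ L) ne
    rewrite unfold-reverse z L | inter-++ x y (reverse L) (z ∷ []) | inter-reverse L ne
          | par-reverse x L | par-∷ x z L | par-∷ y z L | par-∷ y z [] | ∧-zeroʳ (eq x z) | xor-identityʳ (eq y z) =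
    trans (solve 4 (λ f i p q → ((i :+ (p :* q)) :+ con false) :+ (p :* f) := (f :* p) :+ (i :+ (p :* q))) refl
             (eq y z) (inter x y L) (par x L) (par y L))
      (comm-step (eq x z) (eq y z) (inter x y L) (par x L) (par y L) (eq-disjoint z ne))
    where open xor-∧-Solver

  -- A y after the second x is counted twice and cancels; only those between the two x's remain.
  inter-passages : ∀ {x y} p α q → x ≢ y → cnt x p ≡ 0 → cnt x α ≡ 0 → cnt x q ≡ 0 →
    inter x y (p ++ x ∷ α ++ x ∷ q) ≡ par y α
  inter-passages {x} {y} p α q ne xp xα xq
    rewrite inter-++ x y p (x ∷ α ++ x ∷ q) | inter-noˡ y p xp | xp
          | eq-true (refl {x = x}) | par-++ y α (x ∷ q) | par-∷ y x q | eq-false (≢-sym ne)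
          | inter-++ x y α (x ∷ q) | xα | inter-noˡ y α xα | eq-true (refl {x = x}) | inter-noˡ y q xq =
    solve 2 (λ a b → (((a :+ b) :+ ((b :+ con false) :+ con false))) :+ con false := a) refl (par y α) (par y q)
    where open xor-∧-Solver

  inter-reverse-mid : ∀ {x y} p α q → x ≢ y →
    inter x y (p ++ reverse α ++ q) ≡ inter x y (p ++ α ++ q) xor (par x α ∧ par y α)
  inter-reverse-mid {x} {y} p α q ne
    rewrite inter-++ x y p (reverse α ++ q) | inter-++ x y (reverse α) q | inter-reverse α ne
          | par-++ y (reverse α) q | par-reverse y α | par-reverse x α
          | inter-++ x y p (α ++ q) | inter-++ x y α q | par-++ y α q =
    solve 7 (λ i j k a b c d → (i :+ (((j :+ (a :* b)) :+ k) :+ (a :* d))) :+ (c :* (b :+ d))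
                            := ((i :+ ((j :+ k) :+ (a :* d))) :+ (c :* (b :+ d))) :+ (a :* b)) refl
      (inter x y p) (inter x y α) (inter x y q) (par x α) (par y α) (par x p) (par y q)
    where open xor-∧-Solver

  par-exchange : ∀ x m₁ m₂ m₃ q → par x (m₃ ++ m₂ ++ m₁ ++ q) ≡ par x (m₁ ++ m₂ ++ m₃ ++ q)
  par-exchange x m₁ m₂ m₃ q
    rewrite par-++ x m₃ (m₂ ++ m₁ ++ q) | par-++ x m₂ (m₁ ++ q) | par-++ x m₁ q
          | par-++ x m₁ (m₂ ++ m₃ ++ q) | par-++ x m₂ (m₃ ++ q) | par-++ x m₃ q =
    solve 4 (λ a b c d → c :+ (b :+ (a :+ d)) := a :+ (b :+ (c :+ d))) refl (par x m₁) (par x m₂) (par x m₃) (par x q)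
    where open xor-∧-Solver

  -- Exactly the pairs lying in two different blocks change their order. The correction is the sum
  -- of all these mixed products, because the term of `m₂` with itself occurs twice. It is written
  -- with `m₁ ++ m₂` and `m₂ ++ m₃` since these are the stretches between the two passages of each
  -- pivot vertex.
  inter-exchange : ∀ x y p m₁ m₂ m₃ q →
    inter x y (p ++ m₃ ++ m₂ ++ m₁ ++ q) ≡
    inter x y (p ++ m₁ ++ m₂ ++ m₃ ++ q) xor
      ((par x (m₁ ++ m₂) ∧ par y (m₂ ++ m₃)) xor (par x (m₂ ++ m₃) ∧ par y (m₁ ++ m₂)))
  inter-exchange x y p m₁ m₂ m₃ q
    rewrite inter-++ x y p (m₃ ++ m₂ ++ m₁ ++ q) | inter-++ x y p (m₁ ++ m₂ ++ m₃ ++ q)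
          | par-exchange y m₁ m₂ m₃ q
          | inter-++ x y m₃ (m₂ ++ m₁ ++ q) | inter-++ x y m₂ (m₁ ++ q) | inter-++ x y m₁ q
          | inter-++ x y m₁ (m₂ ++ m₃ ++ q) | inter-++ x y m₂ (m₃ ++ q) | inter-++ x y m₃ q
          | par-++ y m₂ (m₁ ++ q) | par-++ y m₁ q | par-++ y m₂ (m₃ ++ q) | par-++ y m₃ q
          | par-++ x m₁ m₂ | par-++ x m₂ m₃ | par-++ y m₁ m₂ | par-++ y m₂ m₃ =
    solve 13 (λ ip i₁ i₂ i₃ iq x₁ x₂ x₃ y₁ y₂ y₃ yq w →
        (ip :+ ((i₃ :+ ((i₂ :+ ((i₁ :+ iq) :+ (x₁ :* yq))) :+ (x₂ :* (y₁ :+ yq)))) :+ (x₃ :* (y₂ :+ (y₁ :+ yq))))) :+ w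
     := ((ip :+ ((i₁ :+ ((i₂ :+ ((i₃ :+ iq) :+ (x₃ :* yq))) :+ (x₂ :* (y₃ :+ yq)))) :+ (x₁ :* (y₂ :+ (y₃ :+ yq))))) :+ w)
        :+ (((x₁ :+ x₂) :* (y₂ :+ y₃)) :+ ((x₂ :+ x₃) :* (y₁ :+ y₂)))) refl
      (inter x y p) (inter x y m₁) (inter x y m₂) (inter x y m₃) (inter x y q)
      (par x m₁) (par x m₂) (par x m₃) (par y m₁) (par y m₂) (par y m₃) (par y q)
      (par x p ∧ par y (m₁ ++ m₂ ++ m₃ ++ q))
    where open xor-∧-Solver

  inter-nested : ∀ {x y} p m q → par x m ≡ false → par y m ≡ false →
    inter x y (p ++ m ++ q) ≡ inter x y m xor inter x y (p ++ q)
  inter-nested {x} {y} p m q xm ym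
    rewrite inter-++ x y p (m ++ q) | inter-++ x y m q | par-++ y m q | inter-++ x y p q | xm | ym =
    solve 4 (λ ip im iq w → (ip :+ ((im :+ iq) :+ con false)) :+ w := im :+ ((ip :+ iq) :+ w)) refl
      (inter x y p) (inter x y m) (inter x y q) (par x p ∧ par y q)
    where open xor-∧-Solver

  cnt-mono : ∀ x {K L} → K ⊆ L → cnt x K ≤ cnt x L
  cnt-mono x []         = z≤n
  cnt-mono x (z ∷ʳ s)   = ≤-trans (cnt-mono x s) (m≤n+m _ (b2n (eq x z)))
  cnt-mono x (refl ∷ s) = +-monoʳ-≤ _ (cnt-mono x s)

  cnt-skip : ∀ x {z K L} → K ⊆ L → cnt x K ≡ cnt x (z ∷ L) → eq x z ≡ false
  cnt-skip x {z} s p with eq x z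
  ... | false = refl
  ... | true  = ⊥-elim (<-irrefl p (s≤s (cnt-mono x s)))

  -- Letters other than x and y do not matter, and equal counts force every dropped letter to be
  -- such a letter.
  inter-⊆ : ∀ {x y K L} → K ⊆ L → cnt x K ≡ cnt x L → cnt y K ≡ cnt y L → inter x y K ≡ inter x y L
  inter-⊆ [] _ _ = refl
  inter-⊆ {x} {y} {K} {z ∷ L} (_ ∷ʳ s) p q =
    trans (inter-⊆ s (skip x p) (skip y q))
      (cong (λ b → (b ∧ par y L) xor inter x y L) (sym (cnt-skip x {z} s p)))
    where
    skip : ∀ x → cnt x K ≡ cnt x (z ∷ L) → cnt x K ≡ cnt x L
    skip x p = trans p (cong (λ b → b2n b + cnt x L) (cnt-skip x {z} s p))
  inter-⊆ {x} {y} {z ∷ K} {_ ∷ L} (refl ∷ s) p q = cong₂ (λ m b → (eq x z ∧ odd m) xor b)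
    (+-cancelˡ-≡ (b2n (eq y z)) _ _ q)
    (inter-⊆ s (+-cancelˡ-≡ (b2n (eq x z)) _ _ p) (+-cancelˡ-≡ (b2n (eq y z)) _ _ q))

  inter-alternating : ∀ {x y L} → x ≢ y → cnt x L ≡ 2 → cnt y L ≡ 2 →
    (x ∷ y ∷ x ∷ y ∷ []) ⊆ L ⊎ (y ∷ x ∷ y ∷ x ∷ []) ⊆ L → inter x y L ≡ true
  inter-alternating {x} {y} ne cx cy (inj₁ s) =
    trans (sym (inter-⊆ s (trans (pattern-x) (sym cx)) (trans pattern-y (sym cy)))) value
    where
    pattern-x : cnt x (x ∷ y ∷ x ∷ y ∷ []) ≡ 2
    pattern-x rewrite eq-true (refl {x = x}) | eq-false ne = refl
    pattern-y : cnt y (x ∷ y ∷ x ∷ y ∷ []) ≡ 2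
    pattern-y rewrite eq-true (refl {x = y}) | eq-false (≢-sym ne) = refl
    value : inter x y (x ∷ y ∷ x ∷ y ∷ []) ≡ true
    value rewrite eq-true (refl {x = x}) | eq-true (refl {x = y}) | eq-false ne | eq-false (≢-sym ne) = refl
  inter-alternating {x} {y} ne cx cy (inj₂ s) =
    trans (sym (inter-⊆ s (trans (pattern-x) (sym cx)) (trans pattern-y (sym cy)))) value
    where
    pattern-x : cnt x (y ∷ x ∷ y ∷ x ∷ []) ≡ 2
    pattern-x rewrite eq-true (refl {x = x}) | eq-false ne = refl
    pattern-y : cnt y (y ∷ x ∷ y ∷ x ∷ []) ≡ 2
    pattern-y rewrite eq-true (refl {x = y}) | eq-false (≢-sym ne) = refl
    value : inter x y (y ∷ x ∷ y ∷ x ∷ []) ≡ true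
    value rewrite eq-true (refl {x = x}) | eq-true (refl {x = y}) | eq-false ne | eq-false (≢-sym ne) = refl

  cnt-tabulate-∉ : ∀ {x m} (f : Fin m → A) → (∀ j → f j ≢ x) → cnt x (tabulate f) ≡ 0
  cnt-tabulate-∉ {m = zero}  f ne = refl
  cnt-tabulate-∉ {m = suc m} f ne rewrite eq-false (≢-sym (ne zero)) = cnt-tabulate-∉ (f ∘ suc) (ne ∘ suc)

  cnt-tabulate : ∀ {m} (f : Fin m → A) → (∀ {i j} → f i ≡ f j → i ≡ j) → ∀ j → cnt (f j) (tabulate f) ≡ 1
  cnt-tabulate f inj zero rewrite eq-true (refl {x = f zero}) =
    cong suc (cnt-tabulate-∉ (f ∘ suc) λ j e → case inj e of λ ())
  cnt-tabulate f inj (suc j) rewrite eq-false {f (suc j)} {f zero} (λ e → case inj e of λ ()) =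
    cnt-tabulate (f ∘ suc) (λ e → Fin.suc-injective (inj e)) j

-- Increasing positions of a tabulated list as sublists, and back.

module _ {A : Set} where

  lookups-⊆₁ : ∀ {m} (f : Fin m → A) j → (f j ∷ []) ⊆ tabulate f
  lookups-⊆₁ f zero    = refl ∷ minimum _
  lookups-⊆₁ f (suc j) = f zero ∷ʳ lookups-⊆₁ (f ∘ suc) j

  lookups-⊆₂ : ∀ {m} (f : Fin m → A) {i j} → i Fin.< j → (f i ∷ f j ∷ []) ⊆ tabulate f
  lookups-⊆₂ f {zero}  {suc j} _       = refl ∷ lookups-⊆₁ (f ∘ suc) j
  lookups-⊆₂ f {suc i} {suc j} (s≤s p) = f zero ∷ʳ lookups-⊆₂ (f ∘ suc) p

  lookups-⊆₃ : ∀ {m} (f : Fin m → A) {i j k} → i Fin.< j → j Fin.< k → (f i ∷ f j ∷ f k ∷ []) ⊆ tabulate f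
  lookups-⊆₃ f {zero}  {suc j} {suc k} _       (s≤s q) = refl ∷ lookups-⊆₂ (f ∘ suc) q
  lookups-⊆₃ f {suc i} {suc j} {suc k} (s≤s p) (s≤s q) = f zero ∷ʳ lookups-⊆₃ (f ∘ suc) p q

  lookups-⊆₄ : ∀ {m} (f : Fin m → A) {i j k l} → i Fin.< j → j Fin.< k → k Fin.< l →
    (f i ∷ f j ∷ f k ∷ f l ∷ []) ⊆ tabulate f
  lookups-⊆₄ f {zero}  {suc j} {suc k} {suc l} _       (s≤s q) (s≤s r) = refl ∷ lookups-⊆₃ (f ∘ suc) q r
  lookups-⊆₄ f {suc i} {suc j} {suc k} {suc l} (s≤s p) (s≤s q) (s≤s r) = f zero ∷ʳ lookups-⊆₄ (f ∘ suc) p q r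

  ⊆-lookups₁ : ∀ {m} (f : Fin m → A) {x} → (x ∷ []) ⊆ tabulate f → ∃ λ i → f i ≡ x
  ⊆-lookups₁ {suc m} f (refl ∷ s) = zero , refl
  ⊆-lookups₁ {suc m} f (_ ∷ʳ s) with ⊆-lookups₁ (f ∘ suc) s
  ... | i , e = suc i , e

  ⊆-lookups₂ : ∀ {m} (f : Fin m → A) {x y} → (x ∷ y ∷ []) ⊆ tabulate f →
    ∃ λ i → ∃ λ j → i Fin.< j × f i ≡ x × f j ≡ y
  ⊆-lookups₂ {suc m} f (refl ∷ s) with ⊆-lookups₁ (f ∘ suc) s
  ... | j , e = zero , suc j , s≤s z≤n , refl , e
  ⊆-lookups₂ {suc m} f (_ ∷ʳ s) with ⊆-lookups₂ (f ∘ suc) s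
  ... | i , j , p , es = suc i , suc j , s≤s p , es

  ⊆-lookups₃ : ∀ {m} (f : Fin m → A) {x y z} → (x ∷ y ∷ z ∷ []) ⊆ tabulate f →
    ∃ λ i → ∃ λ j → ∃ λ k → i Fin.< j × j Fin.< k × f i ≡ x × f j ≡ y × f k ≡ z
  ⊆-lookups₃ {suc m} f (refl ∷ s) with ⊆-lookups₂ (f ∘ suc) s
  ... | j , k , p , es = zero , suc j , suc k , s≤s z≤n , s≤s p , refl , es
  ⊆-lookups₃ {suc m} f (_ ∷ʳ s) with ⊆-lookups₃ (f ∘ suc) s
  ... | i , j , k , p , q , es = suc i , suc j , suc k , s≤s p , s≤s q , es

  ⊆-lookups₄ : ∀ {m} (f : Fin m → A) {x y z t} → (x ∷ y ∷ z ∷ t ∷ []) ⊆ tabulate f →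
    ∃ λ i → ∃ λ j → ∃ λ k → ∃ λ l → i Fin.< j × j Fin.< k × k Fin.< l × f i ≡ x × f j ≡ y × f k ≡ z × f l ≡ t
  ⊆-lookups₄ {suc m} f (refl ∷ s) with ⊆-lookups₃ (f ∘ suc) s
  ... | j , k , l , p , q , es = zero , suc j , suc k , suc l , s≤s z≤n , s≤s p , s≤s q , refl , es
  ⊆-lookups₄ {suc m} f (_ ∷ʳ s) with ⊆-lookups₄ (f ∘ suc) s
  ... | i , j , k , l , p , q , r , es = suc i , suc j , suc k , suc l , s≤s p , s≤s q , s≤s r , es

-- Pigeonhole: a fifth distinct value would embed `Fin 5` into `Fin 4`.
fin4-exhaust : (i j k l : Fin 4) → i ≢ j → i ≢ k → i ≢ l → j ≢ k → j ≢ l → k ≢ l →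
  ∀ m → m ≡ i ⊎ m ≡ j ⊎ m ≡ k ⊎ m ≡ l
fin4-exhaust i j k l ij ik il jk jl kl m with m Fin.≟ i | m Fin.≟ j | m Fin.≟ k | m Fin.≟ l
... | yes p | _     | _     | _     = inj₁ p
... | no _  | yes p | _     | _     = inj₂ (inj₁ p)
... | no _  | no _  | yes p | _     = inj₂ (inj₂ (inj₁ p))
... | no _  | no _  | no _  | yes p = inj₂ (inj₂ (inj₂ p))
... | no mi | no mj | no mk | no ml =
  ⊥-elim (<-irrefl refl (injective⇒≤ {m = 5} {n = 4} (VecUnique.lookup-injective distinct-five _ _)))
  where
  open Vec using ([]; _∷_)
  open VecAll using ([]; _∷_)
  open VecAllPairs using ([]; _∷_)
  distinct-five : VecUnique.Unique (m ∷ i ∷ j ∷ k ∷ l ∷ [])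
  distinct-five = (mi ∷ mj ∷ mk ∷ ml ∷ []) ∷ (ij ∷ ik ∷ il ∷ []) ∷ (jk ∷ jl ∷ []) ∷ (kl ∷ []) ∷ [] ∷ []

_≟ₕ_ : ∀ {n} → DecidableEquality (HE n)
_≟ₕ_ = ≡-dec Fin._≟_ Fin._≟_

module V {n : ℕ} = Counting (Fin._≟_ {n})
module H {n : ℕ} = Counting (_≟ₕ_ {n})

half-edge-exhaust : ∀ {n} {h₁ h₂ h₃ h₄ h : HE n} →
  vert h₁ ≡ vert h → vert h₂ ≡ vert h → vert h₃ ≡ vert h → vert h₄ ≡ vert h →
  h₁ ≢ h₂ → h₁ ≢ h₃ → h₁ ≢ h₄ → h₂ ≢ h₃ → h₂ ≢ h₄ → h₃ ≢ h₄ →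
  h ≡ h₁ ⊎ h ≡ h₂ ⊎ h ≡ h₃ ⊎ h ≡ h₄
half-edge-exhaust {h₁ = u , i} {_ , j} {_ , k} {_ , l} {_ , m} refl refl refl refl ij ik il jk jl kl
  with fin4-exhaust i j k l (ij ∘ cong (u ,_)) (ik ∘ cong (u ,_)) (il ∘ cong (u ,_))
                            (jk ∘ cong (u ,_)) (jl ∘ cong (u ,_)) (kl ∘ cong (u ,_)) m
... | inj₁ refl               = inj₁ refl
... | inj₂ (inj₁ refl)        = inj₂ (inj₁ refl)
... | inj₂ (inj₂ (inj₁ refl)) = inj₂ (inj₂ (inj₁ refl))
... | inj₂ (inj₂ (inj₂ refl)) = inj₂ (inj₂ (inj₂ refl))

-- Three local complementations along an edge.

lc-loopless : ∀ {n} (G : BGraph n) u → (∀ x → adj G x x ≡ false) → ∀ x → adj (lc G u) x x ≡ false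
lc-loopless G u ll x rewrite ll x | V.eq-true (refl {x = x}) | ∧-zeroʳ (adj G u x) = ∧-zeroʳ (adj G u x)

lc-adj : ∀ {n} (G : BGraph n) u {x y} → x ≢ y → adj (lc G u) x y ≡ adj G x y xor (adj G u x ∧ adj G u y)
lc-adj G u {x} {y} ne rewrite V.eq-false ne | ∧-identityʳ (adj G u y) = refl

-- The values at x of the neighbourhood indicators of u in G, of v in lc G u and of u in
-- lc (lc G u) v, followed by the indicators of the closed neighbourhoods of u and v in G.
data PivotRow : (is-u uₓ vₓ α β U V : Bool) → Set where
  other : ∀ s t → PivotRow false s t (t xor s) t s t
  at-u  : PivotRow true false true true false true true
  at-v  : PivotRow false true false false true true true

-- Each of the three complementations adds a product of a vector with itself, and the three products
-- sum to an alternating form in the two closed neighbourhoods. The row of u against itself is the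
-- single exception, left side true and right side false, hence the hypothesis on `e₁ ∧ e₂`.
pivot-row-sum : ∀ {e₁ u₁ v₁ α₁ β₁ U₁ V₁ e₂ u₂ v₂ α₂ β₂ U₂ V₂} →
  PivotRow e₁ u₁ v₁ α₁ β₁ U₁ V₁ → PivotRow e₂ u₂ v₂ α₂ β₂ U₂ V₂ → e₁ ∧ e₂ ≡ false →
  (u₁ ∧ u₂) xor ((α₁ ∧ α₂) xor (β₁ ∧ β₂)) ≡ (U₁ ∧ V₂) xor (V₁ ∧ U₂)
pivot-row-sum (other s t) (other s′ t′) _ =
  solve 4 (λ s t s′ t′ → (s :* s′) :+ (((t :+ s) :* (t′ :+ s′)) :+ (t :* t′)) := (s :* t′) :+ (t :* s′)) refl s t s′ t′
  where open xor-∧-Solver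
pivot-row-sum (other true  true)  at-u _ = refl
pivot-row-sum (other true  false) at-u _ = refl
pivot-row-sum (other false true)  at-u _ = refl
pivot-row-sum (other false false) at-u _ = refl
pivot-row-sum (other true  true)  at-v _ = refl
pivot-row-sum (other true  false) at-v _ = refl
pivot-row-sum (other false true)  at-v _ = refl
pivot-row-sum (other false false) at-v _ = refl
pivot-row-sum at-u (other true  true)  _ = refl
pivot-row-sum at-u (other true  false) _ = refl
pivot-row-sum at-u (other false true)  _ = refl
pivot-row-sum at-u (other false false) _ = refl
pivot-row-sum at-u at-v _ = refl
pivot-row-sum at-v (other true  true)  _ = refl
pivot-row-sum at-v (other true  false) _ = refl
pivot-row-sum at-v (other false true)  _ = refl
pivot-row-sum at-v (other false false) _ = refl
pivot-row-sum at-v at-u _ = refl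
pivot-row-sum at-v at-v _ = refl

module Pivot {n} (G : BGraph n) (u v : Fin n) (ll : ∀ x → adj G x x ≡ false)
  (uv : adj G u v ≡ true) (vu : adj G v u ≡ true) where

  G₁ G₂ G₃ : BGraph n
  G₁ = lc G u
  G₂ = lc G₁ v
  G₃ = lc G₂ u

  -- The neighbourhood is closed because on the tour it becomes the parity of the block that starts
  -- with one passage of w and stops before the other.
  nbhd : Fin n → Fin n → Bool
  nbhd w x = adj G w x xor V.eq x w

  u≢v : u ≢ v
  u≢v refl with trans (sym uv) (ll u)
  ... | ()

  adj₁ : ∀ {x} → v ≢ x → adj G₁ v x ≡ adj G v x xor adj G u x
  adj₁ ne = trans (lc-adj G u ne) (cong (λ b → adj G v _ xor (b ∧ adj G u _)) uv)

  adj₂ : ∀ {x} → u ≢ x → adj G₂ u x ≡ adj G u x xor adj G₁ v x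
  adj₂ {x} ne = trans (lc-adj G₁ v ne) (cong₂ (λ a b → a xor (b ∧ adj G₁ v x))
    (trans (lc-adj G u ne) (trans (cong (λ b → adj G u x xor (b ∧ adj G u x)) (ll u)) (xor-identityʳ (adj G u x))))
    (trans (adj₁ (≢-sym u≢v)) (cong₂ _xor_ vu (ll u))))

  row-at : ∀ {u₁ v₁ α₁ β₁ e₂} x e₁ → V.eq x u ≡ e₁ → V.eq x v ≡ e₂ →
    adj G u x ≡ u₁ → adj G v x ≡ v₁ → adj G₁ v x ≡ α₁ → adj G₂ u x ≡ β₁ →
    PivotRow e₁ u₁ v₁ α₁ β₁ (u₁ xor e₁) (v₁ xor e₂) →
    PivotRow (V.eq x u) (adj G u x) (adj G v x) (adj G₁ v x) (adj G₂ u x) (nbhd u x) (nbhd v x)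
  row-at x e₁ p q r s t w row rewrite p | q | r | s | t | w = row

  row : ∀ x → PivotRow (V.eq x u) (adj G u x) (adj G v x) (adj G₁ v x) (adj G₂ u x) (nbhd u x) (nbhd v x)
  row x = row′ (V.eq x u) (V.eq x v) refl refl
    where
    row′ : ∀ d e → V.eq x u ≡ d → V.eq x v ≡ e →
      PivotRow (V.eq x u) (adj G u x) (adj G v x) (adj G₁ v x) (adj G₂ u x) (nbhd u x) (nbhd v x)
    row′ true true  p q = ⊥-elim (u≢v (trans (sym (V.eq⇒≡ p)) (V.eq⇒≡ q)))
    row′ true false p q with V.eq⇒≡ p
    ... | refl = row-at x true p q (ll x) vu (trans (adj₁ (≢-sym u≢v)) (cong₂ _xor_ vu (ll x)))
      (lc-loopless G₁ v (lc-loopless G x ll) x) at-u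
    row′ false true p q with V.eq⇒≡ q
    ... | refl = row-at x false p q uv (ll x) (lc-loopless G u ll x)
      (trans (adj₂ u≢v) (cong₂ _xor_ uv (lc-loopless G u ll x))) at-v
    row′ false false p q = row-at x false p q refl refl (adj₁ v≢x)
      (trans (adj₂ (≢-sym (V.eq⇒≢ p))) (trans (cong (adj G u x xor_) (adj₁ v≢x))
        (solve 2 (λ s t → s :+ (t :+ s) := t) refl (adj G u x) (adj G v x))))
      (subst₂ (PivotRow false (adj G u x) (adj G v x) (adj G v x xor adj G u x) (adj G v x))
        (sym (xor-identityʳ _)) (sym (xor-identityʳ _)) (other (adj G u x) (adj G v x)))
      where
      open xor-∧-Solver
      v≢x : v ≢ x
      v≢x = ≢-sym (V.eq⇒≢ q)

  -- The right side is symmetric in u and v, so the words uvu and vuv yield the same adjacency, and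
  -- one exchange of segments realises both.
  pivot-adj : ∀ {x y} → x ≢ y → adj G₃ x y ≡ adj G x y xor ((nbhd u x ∧ nbhd v y) xor (nbhd v x ∧ nbhd u y))
  pivot-adj {x} {y} ne = begin
    adj G₃ x y
      ≡⟨ lc-adj G₂ u ne ⟩
    adj G₂ x y xor (adj G₂ u x ∧ adj G₂ u y)
      ≡⟨ cong (_xor (adj G₂ u x ∧ adj G₂ u y))
          (trans (lc-adj G₁ v ne) (cong (_xor (adj G₁ v x ∧ adj G₁ v y)) (lc-adj G u ne))) ⟩
    ((adj G x y xor (adj G u x ∧ adj G u y)) xor (adj G₁ v x ∧ adj G₁ v y)) xor (adj G₂ u x ∧ adj G₂ u y)
      ≡⟨ solve 4 (λ a b c d → ((a :+ b) :+ c) :+ d := a :+ (b :+ (c :+ d))) refl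
           (adj G x y) (adj G u x ∧ adj G u y) (adj G₁ v x ∧ adj G₁ v y) (adj G₂ u x ∧ adj G₂ u y) ⟩
    adj G x y xor ((adj G u x ∧ adj G u y) xor ((adj G₁ v x ∧ adj G₁ v y) xor (adj G₂ u x ∧ adj G₂ u y)))
      ≡⟨ cong (adj G x y xor_) (pivot-row-sum (row x) (row y) (not-both (V.eq x u) (V.eq y u) refl refl)) ⟩
    adj G x y xor ((nbhd u x ∧ nbhd v y) xor (nbhd v x ∧ nbhd u y)) ∎
    where
    open ≡-Reasoning
    open xor-∧-Solver
    not-both : ∀ d e → V.eq x u ≡ d → V.eq y u ≡ e → d ∧ e ≡ false
    not-both true  true  p q = ⊥-elim (ne (trans (V.eq⇒≡ p) (sym (V.eq⇒≡ q))))
    not-both true  false p q = refl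
    not-both false e     p q = refl

  pivot-loopless : ∀ x → adj G₃ x x ≡ false
  pivot-loopless = lc-loopless G₂ u (lc-loopless G₁ v (lc-loopless G u ll))

  pivot-black : black G u ≡ true → black G v ≡ true → ∀ x → black G₃ x ≡ black G x
  pivot-black bu bv x rewrite bu | bv = refl

-- Cyclic predecessor.

prev : ∀ {k} → Fin (suc k) → Fin (suc k)
prev zero    = Fin.fromℕ _
prev (suc i) = Fin.inject₁ i

sucMaybe-fromℕ : ∀ k → sucMaybe (Fin.fromℕ k) ≡ nothing
sucMaybe-fromℕ zero    = refl
sucMaybe-fromℕ (suc k) rewrite sucMaybe-fromℕ k = refl

sucMaybe-inject₁ : ∀ {k} (i : Fin k) → sucMaybe (Fin.inject₁ i) ≡ just (suc i)
sucMaybe-inject₁ zero    = refl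
sucMaybe-inject₁ (suc i) rewrite sucMaybe-inject₁ i = refl

next-prev : ∀ {k} (i : Fin (suc k)) → next (prev i) ≡ i
next-prev {k} zero rewrite sucMaybe-fromℕ k   = refl
next-prev (suc i)  rewrite sucMaybe-inject₁ i = refl

prev-next : ∀ {k} (i : Fin (suc k)) → prev (next i) ≡ i
prev-next {k} i with view i
  where
  view : ∀ {k} (i : Fin (suc k)) → i ≡ Fin.fromℕ k ⊎ ∃ λ j → i ≡ Fin.inject₁ j
  view {zero}  zero    = inj₁ refl
  view {suc k} zero    = inj₂ (zero , refl)
  view {suc k} (suc i) with view i
  ... | inj₁ refl       = inj₁ refl
  ... | inj₂ (j , refl) = inj₂ (suc j , refl)
... | inj₁ refl       rewrite sucMaybe-fromℕ k   = refl
... | inj₂ (j , refl) rewrite sucMaybe-inject₁ j = refl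

-- The default c stands for the dart with which the trail goes on after the list; this makes empty
-- segments harmless in concatenations.
first : ∀ {n} → List (HE n) → HE n → HE n
first []      c = c
first (a ∷ _) c = a

first-++ : ∀ {n} (K L : List (HE n)) c → first (K ++ L) c ≡ first K (first L c)
first-++ []      L c = refl
first-++ (a ∷ K) L c = refl

-- Transition systems orthogonal to T, and switching.

module Tours {n : ℕ} (Γ : Graph4 n) (T : TransSys n) where

  T̂ : HE n → HE n
  T̂ (u , i) = u , pair T u i

  T̂-inv : ∀ h → T̂ (T̂ h) ≡ h
  T̂-inv (u , i) = cong (u ,_) (pair-inv T u i)

  T̂-nfix : ∀ h → T̂ h ≢ h
  T̂-nfix (u , i) e = pair-nfix T u i (cong idx e)

  -- Transition systems orthogonal to T are handled as involutions of the edge-ends.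
  record System (τ : HE n → HE n) : Set where
    field
      vp   : ∀ h → vert (τ h) ≡ vert h
      inv  : ∀ h → τ (τ h) ≡ h
      nfix : ∀ h → τ h ≢ h
      orth : ∀ h → T̂ h ≢ τ h

    -- Orthogonality makes the four listed ends pairwise distinct, so they are all the ends at the
    -- vertex.
    exhaust : ∀ h h′ → vert h ≡ vert h′ → h′ ≡ h ⊎ h′ ≡ T̂ h ⊎ h′ ≡ τ h ⊎ h′ ≡ T̂ (τ h)
    exhaust h h′ e = half-edge-exhaust e e (trans (vp h) e) (trans (vp h) e)
      (≢-sym (T̂-nfix h)) (≢-sym (nfix h))
      (λ p → orth h (trans (cong T̂ p) (T̂-inv (τ h))))
      (orth h)
      (λ p → nfix h (sym (trans (sym (T̂-inv h)) (trans (cong T̂ p) (T̂-inv (τ h))))))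
      (≢-sym (T̂-nfix (τ h)))

    -- Of the four possible values of `τ (T̂ h)` three contradict orthogonality or fixed-point
    -- freeness. Thus `T̂` and τ generate a Klein four-group that acts simply transitively on the
    -- ends at each vertex.
    comm : ∀ h → τ (T̂ h) ≡ T̂ (τ h)
    comm h with exhaust h (τ (T̂ h)) (sym (vp (T̂ h)))
    ... | inj₁ p               = ⊥-elim (orth h (trans (sym (inv (T̂ h))) (cong τ p)))
    ... | inj₂ (inj₁ p)        = ⊥-elim (nfix (T̂ h) p)
    ... | inj₂ (inj₂ (inj₁ p)) = ⊥-elim (T̂-nfix h (trans (sym (inv (T̂ h))) (trans (cong τ p) (inv h))))
    ... | inj₂ (inj₂ (inj₂ p)) = p

    inj : ∀ {h k} → τ h ≡ τ k → h ≡ k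
    inj e = trans (sym (inv _)) (trans (cong τ e) (inv _))

  σ-inj : ∀ {h k} → σ Γ h ≡ σ Γ k → h ≡ k
  σ-inj e = trans (sym (σ-inv Γ _)) (trans (cong (σ Γ) e) (σ-inv Γ _))

  twist : (Fin n → Bool) → HE n → HE n
  twist S h = if S (vert h) then T̂ h else h

  -- At the vertices of S the pairing of τ is replaced by the remaining one of the three, which is
  -- neither that of τ nor that of T.
  flip : (Fin n → Bool) → (HE n → HE n) → HE n → HE n
  flip S τ = twist S ∘ τ

  twist-true : ∀ {S h} → S (vert h) ≡ true → twist S h ≡ T̂ h
  twist-true e rewrite e = refl

  twist-false : ∀ {S h} → S (vert h) ≡ false → twist S h ≡ h
  twist-false e rewrite e = refl

  vert-twist : ∀ S h → vert (twist S h) ≡ vert h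
  vert-twist S h with S (vert h)
  ... | true  = refl
  ... | false = refl

  flip-true : ∀ {S τ} → System τ → ∀ {h} → S (vert h) ≡ true → flip S τ h ≡ T̂ (τ h)
  flip-true {S} sys {h} e = twist-true {S} (trans (cong S (System.vp sys h)) e)

  flip-false : ∀ {S τ} → System τ → ∀ {h} → S (vert h) ≡ false → flip S τ h ≡ τ h
  flip-false {S} sys {h} e = twist-false {S} (trans (cong S (System.vp sys h)) e)

  flip-system : ∀ S {τ} → System τ → System (flip S τ)
  flip-system S {τ} sys = record { vp = vp′ ; inv = inv′ ; nfix = nfix′ ; orth = orth′ }
    where
    open System sys
    vp′ : ∀ h → vert (flip S τ h) ≡ vert h
    vp′ h = trans (vert-twist S (τ h)) (vp h)
    inv′ : ∀ h → flip S τ (flip S τ h) ≡ h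
    inv′ h with S (vert h) in e
    ... | true  rewrite flip-true {S} sys {h} e | flip-true {S} sys {T̂ (τ h)} (trans (cong S (vp h)) e) =
      trans (cong T̂ (trans (comm (τ h)) (cong T̂ (inv h)))) (T̂-inv h)
    ... | false rewrite flip-false {S} sys {h} e | flip-false {S} sys {τ h} (trans (cong S (vp h)) e) = inv h
    nfix′ : ∀ h → flip S τ h ≢ h
    nfix′ h with S (vert h) in e
    ... | true  rewrite flip-true {S} sys {h} e  = λ p → orth h (trans (cong T̂ (sym p)) (T̂-inv (τ h)))
    ... | false rewrite flip-false {S} sys {h} e = nfix h
    orth′ : ∀ h → T̂ h ≢ flip S τ h
    orth′ h with S (vert h) in e
    ... | true  rewrite flip-true {S} sys {h} e  =
      λ p → nfix h (sym (trans (sym (T̂-inv h)) (trans (cong T̂ p) (T̂-inv (τ h)))))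
    ... | false rewrite flip-false {S} sys {h} e = orth h

  -- Segments and closed trails as lists of darts.

  -- The trail enters a vertex through σ h and leaves it through τ (σ h), finally through c.
  Seg : (HE n → HE n) → List (HE n) → HE n → Set
  Seg τ []      c = ⊤
  Seg τ (a ∷ L) c = τ (σ Γ a) ≡ first L c × Seg τ L c

  seg-++⁻ : ∀ {τ} K {L c} → Seg τ (K ++ L) c → Seg τ K (first L c) × Seg τ L c
  seg-++⁻ []          s       = tt , s
  seg-++⁻ (a ∷ K) {L} {c} (p , s) with seg-++⁻ K s
  ... | s₁ , s₂ = (trans p (first-++ K L c) , s₁) , s₂

  seg-++⁺ : ∀ {τ} K {L c} → Seg τ K (first L c) → Seg τ L c → Seg τ (K ++ L) c
  seg-++⁺ []      s₁ s₂ = s₂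
  seg-++⁺ (a ∷ K) {L} {c} (p , s₁) s₂ = trans p (sym (first-++ K L c)) , seg-++⁺ K s₁ s₂

  -- Turns a segment into an equation between two lists, from which departures and arrivals can be
  -- counted.
  seg-shift : ∀ {τ} L {c} → Seg τ L c → first L c ∷ map (τ ∘ σ Γ) L ≡ L ++ c ∷ []
  seg-shift []      s       = refl
  seg-shift {τ} (a ∷ L) {c} (p , s) = cong (a ∷_)
    (trans (cong (_∷ map (τ ∘ σ Γ) L) p) (seg-shift L s))

  seg-cong : ∀ {τ τ′} L {c} → (∀ h → τ h ≡ τ′ h) → Seg τ L c → Seg τ′ L c
  seg-cong []      e s       = tt
  seg-cong (a ∷ L) e (p , s) = trans (sym (e _)) p , seg-cong L e s

  -- A segment prescribes only the darts reached after its head. The head may therefore be moved by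
  -- t, and a switch at the two boundary darts affects nothing but the continuation c.
  seg-∘ : ∀ {τ} t a A {c} → (∀ {k} → k ∈ A → t k ≡ k) → Seg τ (a ∷ A) c → Seg (t ∘ τ) (a ∷ A) (t c)
  seg-∘ t a []      f (p , s) = cong t p , tt
  seg-∘ t a (b ∷ A) f (p , s) = trans (cong t p) (f (here refl)) , seg-∘ t b A (f ∘ there) s

  seg-∘′ : ∀ {τ} t P {c} → (∀ {k} → k ∈ P → t k ≡ k) → Seg τ P c → Seg (t ∘ τ) P (t c)
  seg-∘′ t []      f s = tt
  seg-∘′ t (a ∷ P) f s = seg-∘ t a P (f ∘ there) s

  first-∘ : ∀ (t : HE n → HE n) P {c} → (∀ {k} → k ∈ P → t k ≡ k) → t (first P c) ≡ first P (t c)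
  first-∘ t []      f = refl
  first-∘ t (a ∷ P) f = f (here refl)

  backward : List (HE n) → List (HE n)
  backward K = map (σ Γ) (reverse K)

  backward-∷ : ∀ a K → backward (a ∷ K) ≡ backward K ++ σ Γ a ∷ []
  backward-∷ a K = trans (cong (map (σ Γ)) (unfold-reverse a K)) (map-++ (σ Γ) (reverse K) (a ∷ []))

  first-backward : ∀ {τ} → System τ → ∀ a A {c} d → Seg τ (a ∷ A) c → first (backward (a ∷ A)) d ≡ τ c
  first-backward {τ} sys a [] d (p , s) = trans (sym (System.inv sys _)) (cong τ p)
  first-backward sys a (b ∷ A) d (p , s)
    rewrite backward-∷ a (b ∷ A) | first-++ (backward (b ∷ A)) (σ Γ a ∷ []) d = first-backward sys b A _ s

  -- Since τ is an involution the passages can be read in either direction; walking backwards out of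
  -- a leaves through its τ-partner.
  seg-backward : ∀ {τ} → System τ → ∀ a A {c} → Seg τ (a ∷ A) c → Seg τ (backward (a ∷ A)) (τ a)
  seg-backward {τ} sys a []      (p , s) = cong τ (σ-inv Γ a) , tt
  seg-backward {τ} sys a (b ∷ A) (p , s) rewrite backward-∷ a (b ∷ A) =
    seg-++⁺ (backward (b ∷ A))
      (subst (Seg τ (backward (b ∷ A))) (trans (cong τ (sym p)) (System.inv sys _)) (seg-backward sys b A s))
      (cong τ (σ-inv Γ a) , tt)

  -- The continuation c is required to be the first dart of the list itself. The empty list is not
  -- excluded, so nonemptiness is carried separately wherever cycles are built.
  Closed : (HE n → HE n) → List (HE n) → Set
  Closed τ L = ∃ λ c → Seg τ L c × first L c ≡ c

  closed-++⁻ : ∀ {τ} P {a N} → Closed τ (P ++ a ∷ N) → Seg τ P a × Seg τ (a ∷ N) (first P a)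
  closed-++⁻ P {a} {N} (c , s , e) with seg-++⁻ P s
  ... | s₁ , s₂ = s₁ , subst (Seg _ (a ∷ N)) (trans (sym e) (first-++ P (a ∷ N) c)) s₂

  closed-++⁺ : ∀ {τ} P {N e} → (∀ c → first N c ≡ e) → Seg τ P e → Seg τ N (first P e) → Closed τ (P ++ N)
  closed-++⁺ {τ} P {N} {e} f s₁ s₂ =
    first P e ,
    seg-++⁺ P (subst (Seg τ P) (sym (f (first P e))) s₁) s₂ ,
    trans (first-++ P N (first P e)) (cong (first P) (f (first P e)))

  wd : List (HE n) → List (Fin n)
  wd = map vert

  avoids : ∀ {x k L} → V.cnt x (wd L) ≡ 0 → k ∈ L → vert k ≢ x
  avoids e k∈L refl = V.cnt≡0⇒∉ e (∈-map⁺ vert k∈L)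

  split-vert : ∀ x L {m} → V.cnt x (wd L) ≡ suc m →
    ∃ λ P → ∃ λ a → ∃ λ N → L ≡ P ++ a ∷ N × vert a ≡ x × V.cnt x (wd P) ≡ 0 × V.cnt x (wd N) ≡ m
  split-vert x (k ∷ L) e with x Fin.≟ vert k
  ... | yes refl = [] , k , L , refl , refl , refl , suc-injective e
  ... | no ne with split-vert x L e
  ...   | P , a , N , refl , va , cP , cN = k ∷ P , a , N , refl , va , trans (V.cnt-there (wd P) ne) cP , cN

  record Passages (x : Fin n) (L : List (HE n)) : Set where
    field
      {P A Q} : List (HE n)
      {a b}   : HE n
      eqn     : L ≡ P ++ (a ∷ A) ++ b ∷ Q
      va      : vert a ≡ x
      vb      : vert b ≡ x
      xP      : V.cnt x (wd P) ≡ 0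
      xA      : V.cnt x (wd A) ≡ 0
      xQ      : V.cnt x (wd Q) ≡ 0

    a∈ : a ∈ L
    a∈ rewrite eqn = ∈-++⁺ʳ P (here refl)

    b∈ : b ∈ L
    b∈ rewrite eqn = ∈-++⁺ʳ P (there (∈-++⁺ʳ A (here refl)))

    only : ∀ {k} → k ∈ L → vert k ≡ x → k ≡ a ⊎ k ≡ b
    only k∈ vk rewrite eqn with ∈-++⁻ P k∈
    ... | inj₁ i         = ⊥-elim (avoids xP i vk)
    ... | inj₂ (here e)  = inj₁ e
    ... | inj₂ (there i) with ∈-++⁻ A i
    ...   | inj₁ j         = ⊥-elim (avoids xA j vk)
    ...   | inj₂ (here e)  = inj₂ e
    ...   | inj₂ (there j) = ⊥-elim (avoids xQ j vk)

  passages : ∀ x L → V.cnt x (wd L) ≡ 2 → Passages x L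
  passages x L e with split-vert x L e
  ... | P , a , N , refl , va , cP , cN with split-vert x N cN
  ...   | A , b , Q , refl , vb , cA , cQ =
    record { eqn = refl ; va = va ; vb = vb ; xP = cP ; xA = cA ; xQ = cQ }

  passages-≢ : ∀ {x L} (p : Passages x L) → H.cnt (Passages.a p) L ≤ 1 → Passages.a p ≢ Passages.b p
  passages-≢ {L = L} record { P = P ; A = A ; Q = Q ; a = a ; eqn = refl } le refl =
    <-irrefl refl (≤-trans (H.cnt-repeated a P A Q) le)

  module _ {τ} (sys : System τ) where
    open System sys

    -- By `exhaust` a dart at the vertex is exactly one of four ends; the sum groups them into the
    -- two pairs of τ.
    cnt-vert : ∀ h M → V.cnt (vert h) (wd M) ≡ (H.cnt h M + H.cnt (τ h) M) + (H.cnt (T̂ h) M + H.cnt (T̂ (τ h)) M)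
    cnt-vert h []      = refl
    cnt-vert h (k ∷ M) = trans (cong₂ _+_ one (cnt-vert h M))
      (solve 8 (λ a b c d e f g i → ((a :+ b) :+ (c :+ d)) :+ ((e :+ f) :+ (g :+ i))
                                 := ((a :+ e) :+ (b :+ f)) :+ ((c :+ g) :+ (d :+ i))) refl
        (b2n (H.eq h k)) (b2n (H.eq (τ h) k)) (b2n (H.eq (T̂ h) k)) (b2n (H.eq (T̂ (τ h)) k)) _ _ _ _)
      where
      open ℕ-Solver.+-*-Solver
      h≢Th   = ≢-sym (T̂-nfix h)
      h≢τh   = ≢-sym (nfix h)
      τh≢Tτh = ≢-sym (T̂-nfix (τ h))
      h≢Tτh : h ≢ T̂ (τ h)
      h≢Tτh p = orth h (trans (cong T̂ p) (T̂-inv (τ h)))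
      Th≢Tτh : T̂ h ≢ T̂ (τ h)
      Th≢Tτh p = h≢τh (trans (sym (T̂-inv h)) (trans (cong T̂ p) (T̂-inv (τ h))))
      one′ : ∀ d → V.eq (vert h) (vert k) ≡ d → b2n d
           ≡ (b2n (H.eq h k) + b2n (H.eq (τ h) k)) + (b2n (H.eq (T̂ h) k) + b2n (H.eq (T̂ (τ h)) k))
      one′ false e
        rewrite H.eq-false {x = h} {k} (V.eq⇒≢ e ∘ cong vert)
              | H.eq-false {x = τ h} {k} (λ p → V.eq⇒≢ e (trans (sym (vp h)) (cong vert p)))
              | H.eq-false {x = T̂ h} {k} (V.eq⇒≢ e ∘ cong vert)
              | H.eq-false {x = T̂ (τ h)} {k} (λ p → V.eq⇒≢ e (trans (sym (vp h)) (cong vert p))) = refl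
      one′ true e with exhaust h k (V.eq⇒≡ e)
      ... | inj₁ refl
            rewrite H.eq-true {x = k} refl | H.eq-false (≢-sym h≢τh) | H.eq-false (≢-sym h≢Th)
                  | H.eq-false (≢-sym h≢Tτh) = refl
      ... | inj₂ (inj₁ refl)
            rewrite H.eq-true {x = T̂ h} refl | H.eq-false h≢Th | H.eq-false (≢-sym (orth h))
                  | H.eq-false (≢-sym Th≢Tτh) = refl
      ... | inj₂ (inj₂ (inj₁ refl))
            rewrite H.eq-true {x = τ h} refl | H.eq-false h≢τh | H.eq-false (orth h)
                  | H.eq-false (≢-sym τh≢Tτh) = refl
      ... | inj₂ (inj₂ (inj₂ refl))
            rewrite H.eq-true {x = T̂ (τ h)} refl | H.eq-false h≢Tτh | H.eq-false Th≢Tτh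
                  | H.eq-false τh≢Tτh = refl
      one : b2n (V.eq (vert h) (vert k))
          ≡ (b2n (H.eq h k) + b2n (H.eq (τ h) k)) + (b2n (H.eq (T̂ h) k) + b2n (H.eq (T̂ (τ h)) k))
      one = one′ _ refl

    τσ-inj : ∀ {h k} → τ (σ Γ h) ≡ τ (σ Γ k) → h ≡ k
    τσ-inj = σ-inj ∘ inj

    -- Each arrival through h is followed by a departure through `τ h`; only the first dart and the
    -- continuation disturb the balance, and for a closed list these two cancel.
    seg-cnt : ∀ L {c} → Seg τ L c → ∀ h →
      b2n (H.eq (τ h) (first L c)) + H.cnt (σ Γ h) L ≡ H.cnt (τ h) L + b2n (H.eq (τ h) c)
    seg-cnt L {c} s h = begin
      b2n (H.eq (τ h) (first L c)) + H.cnt (σ Γ h) L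
        ≡⟨ cong (b2n (H.eq (τ h) (first L c)) +_) (sym (H.cnt-map τσ-inj (σ Γ h) L)) ⟩
      b2n (H.eq (τ h) (first L c)) + H.cnt (τ (σ Γ (σ Γ h))) (map (τ ∘ σ Γ) L)
        ≡⟨ cong (λ k → b2n (H.eq (τ h) (first L c)) + H.cnt (τ k) (map (τ ∘ σ Γ) L)) (σ-inv Γ h) ⟩
      H.cnt (τ h) (first L c ∷ map (τ ∘ σ Γ) L)
        ≡⟨ cong (H.cnt (τ h)) (seg-shift L s) ⟩
      H.cnt (τ h) (L ++ c ∷ [])
        ≡⟨ H.cnt-++ (τ h) L (c ∷ []) ⟩
      H.cnt (τ h) L + (b2n (H.eq (τ h) c) + 0)
        ≡⟨ cong (H.cnt (τ h) L +_) (+-identityʳ _) ⟩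
      H.cnt (τ h) L + b2n (H.eq (τ h) c) ∎
      where open ≡-Reasoning

    closed-cnt : ∀ {L} → Closed τ L → ∀ h → H.cnt (τ h) L ≡ H.cnt (σ Γ h) L
    closed-cnt {L} (c , s , e) h = +-cancelˡ-≡ (b2n (H.eq (τ h) c)) _ _
      (trans (+-comm (b2n (H.eq (τ h) c)) _)
        (trans (sym (seg-cnt L s h)) (cong (λ k → b2n (H.eq (τ h) k) + H.cnt (σ Γ h) L) e)))

    seg-par : ∀ L {c} → Seg τ L c → ∀ h →
      H.par (σ Γ h) L ≡ H.par (τ h) L xor (H.eq (τ h) (first L c) xor H.eq (τ h) c)
    seg-par L {c} s h = xor-move (H.eq (τ h) (first L c)) (H.par (σ Γ h) L) (H.par (τ h) L) (H.eq (τ h) c)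
      (begin
      H.eq (τ h) (first L c) xor H.par (σ Γ h) L
        ≡⟨ cong (_xor H.par (σ Γ h) L) (sym (odd-b2n (H.eq (τ h) (first L c)))) ⟩
      odd (b2n (H.eq (τ h) (first L c))) xor H.par (σ Γ h) L
        ≡⟨ sym (odd-+ (b2n (H.eq (τ h) (first L c))) _) ⟩
      odd (b2n (H.eq (τ h) (first L c)) + H.cnt (σ Γ h) L)
        ≡⟨ cong odd (seg-cnt L s h) ⟩
      odd (H.cnt (τ h) L + b2n (H.eq (τ h) c))
        ≡⟨ odd-+ (H.cnt (τ h) L) _ ⟩
      H.par (τ h) L xor odd (b2n (H.eq (τ h) c))
        ≡⟨ cong (H.par (τ h) L xor_) (odd-b2n (H.eq (τ h) c)) ⟩
      H.par (τ h) L xor H.eq (τ h) c ∎)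
      where
      open ≡-Reasoning
      xor-move : ∀ a b c d → a xor b ≡ c xor d → b ≡ c xor (a xor d)
      xor-move true  b true  d e = trans (sym (not-involutive b)) (cong not e)
      xor-move true  b false d e = trans (sym (not-involutive b)) (cong not e)
      xor-move false b c     d e = e

  -- Euler tours and the bicoloured graphs they represent.

  record Tour (τ : HE n → HE n) (L : List (HE n)) : Set where
    field
      sys    : System τ
      closed : Closed τ L
      euler  : ∀ h → H.cnt h L + H.cnt (σ Γ h) L ≡ 1
    open System sys

    ∈⇒cnt : ∀ {h} → h ∈ L → H.cnt h L ≡ 1
    ∈⇒cnt {h} h∈ with H.∈⇒cnt>0 h∈ | euler h
    ... | m , e | e′ rewrite e = cong suc (m+n≡0⇒m≡0 m (suc-injective e′))

    ∈⇒par : ∀ {h} → h ∈ L → H.par h L ≡ true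
    ∈⇒par h∈ = cong odd (∈⇒cnt h∈)

    par⇒∈ : ∀ {h} → H.par h L ≡ true → h ∈ L
    par⇒∈ {h} e with H.cnt h L in c
    ... | suc m = H.cnt>0⇒∈ L c

    par-σ : ∀ h → H.par (σ Γ h) L ≡ not (H.par h L)
    par-σ h with H.cnt h L | H.cnt (σ Γ h) L | euler h
    ... | 0           | 1 | refl = refl
    ... | 1           | 0 | refl = refl

    par-τ : ∀ h → H.par (τ h) L ≡ not (H.par h L)
    par-τ h = trans (cong odd (closed-cnt sys closed h)) (par-σ h)

    -- The ends at x form two pairs of τ, and exactly one end of each pair is a departure.
    twice : ∀ x → V.cnt x (wd L) ≡ 2
    twice x = begin
      V.cnt x (wd L)                                                             ≡⟨ cnt-vert sys h L ⟩
      (H.cnt h L + H.cnt (τ h) L) + (H.cnt (T̂ h) L + H.cnt (T̂ (τ h)) L)          ≡⟨ cong₂ _+_ pass pass′ ⟩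
      2 ∎
      where
      open ≡-Reasoning
      h : HE n
      h = x , zero
      pass : H.cnt h L + H.cnt (τ h) L ≡ 1
      pass = trans (cong (H.cnt h L +_) (closed-cnt sys closed h)) (euler h)
      pass′ : H.cnt (T̂ h) L + H.cnt (T̂ (τ h)) L ≡ 1
      pass′ = trans (cong (λ k → H.cnt (T̂ h) L + H.cnt k L) (sym (comm h)))
                (trans (cong (H.cnt (T̂ h) L +_) (closed-cnt sys closed (T̂ h))) (euler (T̂ h)))

    module _ {x} (p : Passages x L) where
      open Passages p

      a≢b : a ≢ b
      a≢b = passages-≢ p (≤-reflexive (∈⇒cnt a∈))

      at-x : ∀ {k} → vert k ≡ x → H.eq k a xor H.eq k b ≡ H.par k L
      at-x {k} vk with k ≟ₕ a | k ≟ₕ b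
      ... | yes p | yes q = ⊥-elim (a≢b (trans (sym p) q))
      ... | yes refl | no _ = sym (∈⇒par a∈)
      ... | no _ | yes refl = sym (∈⇒par b∈)
      ... | no ¬p | no ¬q with H.cnt k L in e
      ...   | zero  = refl
      ...   | suc m with only (H.cnt>0⇒∈ L e) vk
      ...     | inj₁ p = ⊥-elim (¬p p)
      ...     | inj₂ q = ⊥-elim (¬q q)

  -- H.par h L tells whether L departs along h, so at a black vertex T pairs departing ends with each
  -- other, at a white one it pairs departing ends with entering ends.
  record Represents (τ : HE n → HE n) (L : List (HE n)) (G : BGraph n) : Set where
    field
      tour     : Tour τ L
      adjacent : ∀ {x y} → x ≢ y → adj G x y ≡ V.inter x y (wd L)
      loopless : ∀ x → adj G x x ≡ false
      colour   : ∀ h → H.par (T̂ h) L xor H.par h L ≡ not (black G (vert h))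
    open Tour tour public
    open System sys public

    -- The product term of `inter-comm` vanishes because x occurs twice.
    adj-sym : ∀ x y → adj G x y ≡ adj G y x
    adj-sym x y with x Fin.≟ y
    ... | yes refl = refl
    ... | no ne = trans (adjacent ne) (sym (trans (adjacent (≢-sym ne)) (trans (V.inter-comm (wd L) ne)
      (trans (cong (V.inter x y (wd L) xor_) (cong (λ m → odd m ∧ V.par y (wd L)) (twice x))) (xor-identityʳ _)))))

    module _ {x} (p : Passages x L) where
      open Passages p

      adj-passages : ∀ y → adj G x y ≡ V.par y (wd A)
      adj-passages y with x Fin.≟ y
      ... | yes refl = trans (loopless x) (cong odd (sym xA))
      ... | no ne = trans (adjacent ne) (trans (cong (V.inter x y ) word) (V.inter-passages (wd P) (wd A) (wd Q) ne xP xA xQ))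
        where
        word : wd L ≡ wd P ++ x ∷ wd A ++ x ∷ wd Q
        word rewrite eqn | map-++ vert P ((a ∷ A) ++ b ∷ Q) | map-++ vert A (b ∷ Q) | va | vb = refl

      -- At a black vertex the T-partner of the departure a departs as well, so it is the other
      -- departure b.
      black-passages : black G x ≡ true → T̂ a ≡ b
      black-passages bl with only Ta∈ va
        where
        Ta∈ : T̂ a ∈ L
        Ta∈ = par⇒∈ (trans (sym (xor-true (H.par (T̂ a) L) (H.par a L)
          (trans (colour a) (cong not (trans (cong (black G) va) bl))))) (∈⇒par a∈))
          where
          xor-true : ∀ p q → p xor q ≡ false → q ≡ p
          xor-true true  true  _ = refl
          xor-true false false _ = refl
      ... | inj₁ e = ⊥-elim (T̂-nfix a e)
      ... | inj₂ e = e

      -- At a white vertex the T-partner of a is an arrival. Its τ-partner departs and cannot be a,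
      -- so it is b.
      white-passages : black G x ≡ false → T̂ a ≡ τ b
      white-passages wh with only τTa∈ (trans (vp (T̂ a)) va)
        where
        Ta : H.par (T̂ a) L ≡ false
        Ta = xor-not (H.par (T̂ a) L) (H.par a L)
          (trans (colour a) (cong not (trans (cong (black G) va) wh))) (∈⇒par a∈)
          where
          xor-not : ∀ p q → p xor q ≡ true → q ≡ true → p ≡ false
          xor-not false true _ _ = refl
        τTa∈ : τ (T̂ a) ∈ L
        τTa∈ = par⇒∈ (trans (par-τ (T̂ a)) (cong not Ta))
      ... | inj₁ e = ⊥-elim (orth a (trans (sym (inv (T̂ a))) (cong τ e)))
      ... | inj₂ e = trans (sym (inv (T̂ a))) (cong τ e)

  -- Switching at a white vertex.

  cnt-backward : ∀ h K → H.cnt h (backward K) ≡ H.cnt (σ Γ h) K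
  cnt-backward h K = trans (cong (λ k → H.cnt k (backward K)) (sym (σ-inv Γ h)))
    (trans (H.cnt-map σ-inj (σ Γ h) (reverse K)) (H.cnt-reverse (σ Γ h) K))

  -- A dart turned round starts where its successor started, so `vert a` drops out and `vert c`
  -- comes in. Both are u when the segment runs from one passage of u to the next.
  wd-backward : ∀ {τ} → System τ → ∀ a A {c} → Seg τ (a ∷ A) c → wd (backward (a ∷ A)) ≡ vert c ∷ reverse (wd A)
  wd-backward sys a [] (p , s) = cong (_∷ []) (trans (sym (System.vp sys _)) (cong vert p))
  wd-backward sys a (b ∷ A) {c} (p , s) = begin
    wd (backward (a ∷ b ∷ A))                      ≡⟨ cong wd (backward-∷ a (b ∷ A)) ⟩
    wd (backward (b ∷ A) ++ σ Γ a ∷ [])            ≡⟨ map-++ vert (backward (b ∷ A)) _ ⟩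
    wd (backward (b ∷ A)) ++ vert (σ Γ a) ∷ []
      ≡⟨ cong₂ (λ l v → l ++ v ∷ []) (wd-backward sys b A s) (trans (sym (System.vp sys _)) (cong vert p)) ⟩
    vert c ∷ reverse (wd A) ++ vert b ∷ []         ≡⟨ cong (vert c ∷_) (sym (unfold-reverse (vert b) (wd A))) ⟩
    vert c ∷ reverse (wd (b ∷ A)) ∎
    where open ≡-Reasoning

  flip-fixes : ∀ {u L} → V.cnt u (wd L) ≡ 0 → ∀ {k} → k ∈ L → twist (V.eq u) k ≡ k
  flip-fixes {u} e {k} k∈ = twist-false {V.eq u} (V.eq-false (≢-sym (avoids e k∈)))

  closed-passages : ∀ {τ} P a A {b Q} → Closed τ (P ++ (a ∷ A) ++ b ∷ Q) →
    Seg τ P a × Seg τ (a ∷ A) b × Seg τ (b ∷ Q) (first P a)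
  closed-passages P a A cl with closed-++⁻ P cl
  ... | s₁ , s₂ with seg-++⁻ (a ∷ A) s₂
  ...   | s₃ , s₄ = s₁ , s₃ , s₄

  module WhiteMove {τ L G u} (rep : Represents τ L G) (wh : black G u ≡ false) (p : Passages u L) where
    private
      open Represents rep
      open Passages p
      τ′ : HE n → HE n
      τ′ = flip (V.eq u) τ
      sys′ : System τ′
      sys′ = flip-system (V.eq u) sys
      M L′ : List (HE n)
      M  = a ∷ A
      L′ = P ++ backward M ++ b ∷ Q

      twist-u : ∀ {h} → vert h ≡ u → twist (V.eq u) h ≡ T̂ h
      twist-u e = twist-true {V.eq u} (V.eq-true (sym e))

      Ta≡τb : T̂ a ≡ τ b
      Ta≡τb = white-passages p wh
      Tτa≡b : T̂ (τ a) ≡ b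
      Tτa≡b = trans (sym (comm a)) (trans (cong τ Ta≡τb) (inv b))

      segments : Seg τ P a × Seg τ M b × Seg τ (b ∷ Q) (first P a)
      segments = closed-passages P a A (subst (Closed τ) eqn closed)

      -- The switched trail enters the reversed block through `T̂ a`, which is `τ b`, and leaves it
      -- through `T̂ (τ a)`, which is b. Both equalities come from u being white.
      closed′ : Closed τ′ L′
      closed′ = closed-++⁺ P first-eq
        (subst (Seg τ′ P) (trans (twist-u va) Ta≡τb) (seg-∘′ _ P (flip-fixes xP) (proj₁ segments)))
        (seg-++⁺ (backward M)
          (subst (Seg τ′ (backward M)) (trans (twist-u (trans (vp a) va)) Tτa≡b) (seg-backward sys′ a A forward))
          (subst (Seg τ′ (b ∷ Q)) (trans (first-∘ _ P (flip-fixes xP)) (cong (first P) (trans (twist-u va) Ta≡τb)))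
            (seg-∘ _ b Q (flip-fixes xQ) (proj₂ (proj₂ segments)))))
        where
        forward : Seg τ′ M (twist (V.eq u) b)
        forward = seg-∘ _ a A (flip-fixes xA) (proj₁ (proj₂ segments))
        first-eq : ∀ c → first (backward M ++ b ∷ Q) c ≡ τ b
        first-eq c = trans (first-++ (backward M) (b ∷ Q) c) (trans (first-backward sys′ a A b forward)
          (trans (cong τ′ (twist-u vb)) (trans (twist-u (trans (vp (T̂ b)) vb)) (trans (cong T̂ (comm b)) (T̂-inv (τ b))))))

      euler′ : ∀ h → H.cnt h L′ + H.cnt (σ Γ h) L′ ≡ 1
      euler′ h = trans (cong₂ _+_ (counts h)
          (trans (counts (σ Γ h)) (cong (λ k → H.cnt (σ Γ h) P + (H.cnt k M + H.cnt (σ Γ h) (b ∷ Q))) (σ-inv Γ h))))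
        (trans (solve 6 (λ p m q p′ m′ q′ → (p :+ (m′ :+ q)) :+ (p′ :+ (m :+ q′))
                                         := (p :+ (m :+ q)) :+ (p′ :+ (m′ :+ q′))) refl
                  (H.cnt h P) (H.cnt h M) (H.cnt h (b ∷ Q)) (H.cnt (σ Γ h) P) (H.cnt (σ Γ h) M) (H.cnt (σ Γ h) (b ∷ Q)))
          (trans (sym (cong₂ _+_ (counts₀ h) (counts₀ (σ Γ h)))) (euler h)))
        where
        open ℕ-Solver.+-*-Solver
        counts : ∀ h → H.cnt h L′ ≡ H.cnt h P + (H.cnt (σ Γ h) M + H.cnt h (b ∷ Q))
        counts h = trans (H.cnt-++ h P _) (cong (H.cnt h P +_)
          (trans (H.cnt-++ h (backward M) _) (cong (_+ H.cnt h (b ∷ Q)) (cnt-backward h M))))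
        counts₀ : ∀ h → H.cnt h L ≡ H.cnt h P + (H.cnt h M + H.cnt h (b ∷ Q))
        counts₀ h = trans (cong (H.cnt h) eqn) (trans (H.cnt-++ h P _) (cong (H.cnt h P +_) (H.cnt-++ h M _)))

      par-L′ : ∀ h → H.par h L′ ≡ H.par h L xor (H.par h M xor H.par (σ Γ h) M)
      par-L′ h = begin
        H.par h L′
          ≡⟨ H.par-++ h P _ ⟩
        H.par h P xor H.par h (backward M ++ b ∷ Q)
          ≡⟨ cong (H.par h P xor_) (H.par-++ h (backward M) _) ⟩
        H.par h P xor (H.par h (backward M) xor H.par h (b ∷ Q))
          ≡⟨ cong (λ m → H.par h P xor (odd m xor H.par h (b ∷ Q))) (cnt-backward h M) ⟩
        H.par h P xor (H.par (σ Γ h) M xor H.par h (b ∷ Q))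
          ≡⟨ solve 4 (λ p m q m′ → p :+ (m′ :+ q) := (p :+ (m :+ q)) :+ (m :+ m′)) refl
               (H.par h P) (H.par h M) (H.par h (b ∷ Q)) (H.par (σ Γ h) M) ⟩
        (H.par h P xor (H.par h M xor H.par h (b ∷ Q))) xor (H.par h M xor H.par (σ Γ h) M)
          ≡⟨ cong (_xor (H.par h M xor H.par (σ Γ h) M)) (sym (trans (cong (H.par h) eqn)
               (trans (H.par-++ h P _) (cong (H.par h P xor_) (H.par-++ h M _))))) ⟩
        H.par h L xor (H.par h M xor H.par (σ Γ h) M) ∎
        where
        open ≡-Reasoning
        open xor-∧-Solver

      at-ends : HE n → Bool
      at-ends k = H.eq k a xor H.eq k b

      -- Replaces the end `σ Γ h`, which may lie at another vertex, by `τ h` at the same vertex, so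
      -- that `visits` can sum over the four ends there. The price is a correction at the boundary
      -- darts a and b.
      reversed : ∀ h → H.par h M xor H.par (σ Γ h) M ≡ (H.par h M xor H.par (τ h) M) xor at-ends (τ h)
      reversed h = trans (cong (H.par h M xor_) (seg-par sys M (proj₁ (proj₂ segments)) h))
        (sym (xor-assoc (H.par h M) (H.par (τ h) M) (at-ends (τ h))))

      word : wd L ≡ (wd P ++ u ∷ []) ++ wd A ++ wd (b ∷ Q)
      word = trans (cong wd eqn) (trans (map-++ vert P _)
        (trans (cong (wd P ++_) (cong₂ _∷_ va (map-++ vert A (b ∷ Q)))) (sym (++-assoc (wd P) (u ∷ []) _))))

      word′ : wd L′ ≡ (wd P ++ u ∷ []) ++ reverse (wd A) ++ wd (b ∷ Q)
      word′ = trans (map-++ vert P _) (trans (cong (wd P ++_) (trans (map-++ vert (backward M) (b ∷ Q))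
        (cong (_++ wd (b ∷ Q)) (trans (wd-backward sys a A (proj₁ (proj₂ segments))) (cong (_∷ reverse (wd A)) vb)))))
        (sym (++-assoc (wd P) (u ∷ []) _)))

      adjacent′ : ∀ {x y} → x ≢ y → adj (lc G u) x y ≡ V.inter x y (wd L′)
      adjacent′ {x} {y} ne = begin
        adj (lc G u) x y
          ≡⟨ lc-adj G u ne ⟩
        adj G x y xor (adj G u x ∧ adj G u y)
          ≡⟨ cong₂ _xor_ (trans (adjacent ne) (cong (V.inter x y) word)) (cong₂ _∧_ (adj-passages p x) (adj-passages p y)) ⟩
        V.inter x y ((wd P ++ u ∷ []) ++ wd A ++ wd (b ∷ Q)) xor (V.par x (wd A) ∧ V.par y (wd A))
          ≡⟨ sym (V.inter-reverse-mid (wd P ++ u ∷ []) (wd A) (wd (b ∷ Q)) ne) ⟩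
        V.inter x y ((wd P ++ u ∷ []) ++ reverse (wd A) ++ wd (b ∷ Q))
          ≡⟨ cong (V.inter x y) (sym word′) ⟩
        V.inter x y (wd L′) ∎
        where open ≡-Reasoning

      -- A transition of T joins two different passages, so it sees both passages at a vertex.
      visits : ∀ h → (H.par h M xor H.par (τ h) M) xor (H.par (T̂ h) M xor H.par (τ (T̂ h)) M)
                   ≡ V.eq (vert h) u xor adj G u (vert h)
      visits h = sym (begin
        V.eq (vert h) u xor adj G u (vert h)
          ≡⟨ cong₂ _xor_ (cong (V.eq (vert h)) (sym va)) (adj-passages p (vert h)) ⟩
        V.eq (vert h) (vert a) xor V.par (vert h) (wd A)
          ≡⟨ sym (V.par-∷ (vert h) (vert a) (wd A)) ⟩
        V.par (vert h) (wd M)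
          ≡⟨ cong odd (cnt-vert sys h M) ⟩
        odd ((H.cnt h M + H.cnt (τ h) M) + (H.cnt (T̂ h) M + H.cnt (T̂ (τ h)) M))
          ≡⟨ trans (odd-+ (H.cnt h M + H.cnt (τ h) M) _)
               (cong₂ _xor_ (odd-+ (H.cnt h M) _) (odd-+ (H.cnt (T̂ h) M) _)) ⟩
        (H.par h M xor H.par (τ h) M) xor (H.par (T̂ h) M xor H.par (T̂ (τ h)) M)
          ≡⟨ cong (λ k → (H.par h M xor H.par (τ h) M) xor (H.par (T̂ h) M xor H.par k M)) (sym (comm h)) ⟩
        (H.par h M xor H.par (τ h) M) xor (H.par (T̂ h) M xor H.par (τ (T̂ h)) M) ∎)
        where open ≡-Reasoning

      -- At u the boundary corrections add up to the negated colour of u, which is true because u is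
      -- white. They cancel the summand for u itself in `visits`, so exactly the neighbours of u
      -- change colour.
      ends : ∀ h → at-ends (τ h) xor at-ends (τ (T̂ h)) ≡ V.eq (vert h) u
      ends h = ends′ _ refl
        where
        ends′ : ∀ d → V.eq (vert h) u ≡ d → at-ends (τ h) xor at-ends (τ (T̂ h)) ≡ d
        ends′ false e
          rewrite H.eq-false {x = τ h} {a} (λ q → V.eq⇒≢ e (trans (sym (vp h)) (trans (cong vert q) va)))
                | H.eq-false {x = τ h} {b} (λ q → V.eq⇒≢ e (trans (sym (vp h)) (trans (cong vert q) vb)))
                | H.eq-false {x = τ (T̂ h)} {a} (λ q → V.eq⇒≢ e (trans (sym (vp (T̂ h))) (trans (cong vert q) va)))
                | H.eq-false {x = τ (T̂ h)} {b} (λ q → V.eq⇒≢ e (trans (sym (vp (T̂ h))) (trans (cong vert q) vb))) = refl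
        ends′ true e = begin
          at-ends (τ h) xor at-ends (τ (T̂ h))
            ≡⟨ cong₂ _xor_ (at-x p (trans (vp h) (V.eq⇒≡ e))) (at-x p (trans (vp (T̂ h)) (V.eq⇒≡ e))) ⟩
          H.par (τ h) L xor H.par (τ (T̂ h)) L
            ≡⟨ cong₂ _xor_ (par-τ h) (par-τ (T̂ h)) ⟩
          not (H.par h L) xor not (H.par (T̂ h) L)
            ≡⟨ solve 2 (λ x y → (con true :+ x) :+ (con true :+ y) := y :+ x) refl (H.par h L) (H.par (T̂ h) L) ⟩
          H.par (T̂ h) L xor H.par h L
            ≡⟨ colour h ⟩
          not (black G (vert h))
            ≡⟨ cong not (trans (cong (black G) (V.eq⇒≡ e)) wh) ⟩
          true ∎
          where
          open ≡-Reasoning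
          open xor-∧-Solver

      colour′ : ∀ h → H.par (T̂ h) L′ xor H.par h L′ ≡ not (black (lc G u) (vert h))
      colour′ h = begin
        H.par (T̂ h) L′ xor H.par h L′
          ≡⟨ cong₂ _xor_ (trans (par-L′ (T̂ h)) (cong (H.par (T̂ h) L xor_) (reversed (T̂ h))))
                         (trans (par-L′ h) (cong (H.par h L xor_) (reversed h))) ⟩
        (H.par (T̂ h) L xor ((H.par (T̂ h) M xor H.par (τ (T̂ h)) M) xor at-ends (τ (T̂ h))))
          xor (H.par h L xor ((H.par h M xor H.par (τ h) M) xor at-ends (τ h)))
          ≡⟨ solve 6 (λ p q r s v w → (p :+ (r :+ v)) :+ (q :+ (s :+ w)) := (p :+ q) :+ ((s :+ r) :+ (w :+ v))) refl
               (H.par (T̂ h) L) (H.par h L) (H.par (T̂ h) M xor H.par (τ (T̂ h)) M) (H.par h M xor H.par (τ h) M)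
               (at-ends (τ (T̂ h))) (at-ends (τ h)) ⟩
        (H.par (T̂ h) L xor H.par h L) xor (((H.par h M xor H.par (τ h) M) xor (H.par (T̂ h) M xor H.par (τ (T̂ h)) M))
          xor (at-ends (τ h) xor at-ends (τ (T̂ h))))
          ≡⟨ cong₂ _xor_ (colour h) (cong₂ _xor_ (visits h) (ends h)) ⟩
        not (black G (vert h)) xor ((V.eq (vert h) u xor adj G u (vert h)) xor V.eq (vert h) u)
          ≡⟨ solve 3 (λ c e d → (con true :+ c) :+ ((e :+ d) :+ e) := con true :+ (c :+ d)) refl
               (black G (vert h)) (V.eq (vert h) u) (adj G u (vert h)) ⟩
        not (black G (vert h) xor adj G u (vert h))
          ≡⟨ cong (λ c → not (if c then black G (vert h) else (black G (vert h) xor adj G u (vert h)))) (sym wh) ⟩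
        not (black (lc G u) (vert h)) ∎
        where
        open ≡-Reasoning
        open xor-∧-Solver

    represents : Represents τ′ L′ (lc G u)
    represents = record
      { tour     = record { sys = sys′ ; closed = closed′ ; euler = euler′ }
      ; adjacent = adjacent′
      ; loopless = lc-loopless G u loopless
      ; colour   = colour′
      }

  white-move : ∀ {τ L G u} → Represents τ L G → black G u ≡ false →
    ∃ λ L′ → Represents (flip (V.eq u) τ) L′ (lc G u)
  white-move {L = L} {u = u} rep wh =
    _ , WhiteMove.represents rep wh (passages u L (Represents.twice rep u))

  -- Switching at two interlaced black vertices.

  cnt-two : ∀ {x} P a A {b Q} → vert a ≡ x → vert b ≡ x → V.cnt x (wd (P ++ (a ∷ A) ++ b ∷ Q)) ≡ 2 →
    V.cnt x (wd P) + (V.cnt x (wd A) + V.cnt x (wd Q)) ≡ 0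
  cnt-two {x} P a A {b} {Q} va vb e = +-cancelˡ-≡ 2 _ _ (trans (sym (begin
    V.cnt x (wd (P ++ (a ∷ A) ++ b ∷ Q))
      ≡⟨ trans (cong (V.cnt x) (map-++ vert P _)) (V.cnt-++ x (wd P) _) ⟩
    V.cnt x (wd P) + V.cnt x (vert a ∷ wd (A ++ b ∷ Q))
      ≡⟨ cong (V.cnt x (wd P) +_) (trans (V.cnt-here (wd (A ++ b ∷ Q)) (sym va)) (cong suc
           (trans (cong (V.cnt x) (map-++ vert A (b ∷ Q))) (trans (V.cnt-++ x (wd A) (wd (b ∷ Q)))
             (cong (V.cnt x (wd A) +_) (V.cnt-here (wd Q) (sym vb))))))) ⟩
    V.cnt x (wd P) + suc (V.cnt x (wd A) + suc (V.cnt x (wd Q)))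
      ≡⟨ solve 3 (λ p m q → p :+ (con 1 :+ (m :+ (con 1 :+ q))) := con 2 :+ (p :+ (m :+ q))) refl
           (V.cnt x (wd P)) (V.cnt x (wd A)) (V.cnt x (wd Q)) ⟩
    2 + (V.cnt x (wd P) + (V.cnt x (wd A) + V.cnt x (wd Q))) ∎)) e)
    where
    open ≡-Reasoning
    open ℕ-Solver.+-*-Solver

  passages-at : ∀ {x L} P a A {b Q} → L ≡ P ++ (a ∷ A) ++ b ∷ Q → vert a ≡ x → vert b ≡ x →
    V.cnt x (wd L) ≡ 2 → Passages x L
  passages-at {x} P a A eq va vb e = record
    { P = P ; A = A ; eqn = eq ; va = va ; vb = vb
    ; xP = m+n≡0⇒m≡0 (V.cnt x (wd P)) zs
    ; xA = m+n≡0⇒m≡0 (V.cnt x (wd A)) (m+n≡0⇒n≡0 (V.cnt x (wd P)) zs)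
    ; xQ = m+n≡0⇒n≡0 (V.cnt x (wd A)) (m+n≡0⇒n≡0 (V.cnt x (wd P)) zs)
    }
    where zs = cnt-two P a A va vb (trans (cong (V.cnt x ∘ wd) (sym eq)) e)

  record Crossing (u v : Fin n) (L : List (HE n)) : Set where
    field
      {P A B C Q} : List (HE n)
      {a b a′ b′}   : HE n
      eqn : L ≡ P ++ (a ∷ A) ++ (b ∷ B) ++ (a′ ∷ C) ++ b′ ∷ Q
      va  : vert a ≡ u
      vb  : vert b ≡ v
      va′  : vert a′ ≡ u
      vb′  : vert b′ ≡ v

  -- An odd number of passages of v lies between those of u, hence exactly one. Whether the other
  -- lies before or after decides which of u and v comes first in the list.
  crossing : ∀ {τ L G u v} → Represents τ L G → adj G u v ≡ true → Crossing u v L ⊎ Crossing v u L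
  crossing {L = L} {u = u} {v = v} rep uv with passages u L (Represents.twice rep u)
  ... | p@record { P = P₀ ; A = A₀ ; Q = Q₀ ; a = a ; b = c ; va = va ; vb = vc } = find _ refl
    where
    open Passages p using (eqn)
    open Represents rep
    u≢v : u ≢ v
    u≢v refl with trans (sym uv) (loopless u)
    ... | ()
    total : V.cnt v (wd P₀) + (V.cnt v (wd A₀) + V.cnt v (wd Q₀)) ≡ 2
    total = trans (sym (begin
      V.cnt v (wd L)
        ≡⟨ trans (cong (V.cnt v ∘ wd) eqn) (trans (cong (V.cnt v) (map-++ vert P₀ _)) (V.cnt-++ v (wd P₀) _)) ⟩
      V.cnt v (wd P₀) + V.cnt v (vert a ∷ wd (A₀ ++ c ∷ Q₀))
        ≡⟨ cong (V.cnt v (wd P₀) +_) (trans (V.cnt-there (wd (A₀ ++ c ∷ Q₀)) (λ e → u≢v (sym (trans e va))))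
             (trans (cong (V.cnt v) (map-++ vert A₀ (c ∷ Q₀))) (trans (V.cnt-++ v (wd A₀) (wd (c ∷ Q₀)))
               (cong (V.cnt v (wd A₀) +_) (V.cnt-there (wd Q₀) (λ e → u≢v (sym (trans e vc)))))))) ⟩
      V.cnt v (wd P₀) + (V.cnt v (wd A₀) + V.cnt v (wd Q₀)) ∎)) (twice v)
      where open ≡-Reasoning
    find : ∀ m → V.cnt v (wd A₀) ≡ m → Crossing u v L ⊎ Crossing v u L
    find m e with trans (sym (trans (adj-passages p v) (cong odd e))) uv
    find (suc zero) e | _ = find-other _ refl
      where
      find-other : ∀ k → V.cnt v (wd P₀) ≡ k → Crossing u v L ⊎ Crossing v u L
      find-other (suc k) e′ with split-vert v P₀ e′ | split-vert v A₀ e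
      ... | P , b , B , refl , vb , _ | A , d , D , refl , vd , _ =
        inj₂ record { P = P ; A = B ; B = A ; C = D ; Q = Q₀
                    ; eqn = trans eqn (trans (++-assoc P (b ∷ B) _)
                        (cong (λ l → P ++ b ∷ B ++ a ∷ l) (++-assoc A (d ∷ D) (c ∷ Q₀))))
                    ; va = vb ; vb = va ; va′ = vd ; vb′ = vc }
      find-other zero e′ with split-vert v Q₀ {0} rest | split-vert v A₀ e
        where
        rest : V.cnt v (wd Q₀) ≡ 1
        rest = +-cancelˡ-≡ 1 _ _ (trans (cong₂ (λ p α → p + (α + V.cnt v (wd Q₀))) (sym e′) (sym e)) total)
      ... | C , d , Q , refl , vd , _ | A , b , B , refl , vb , _ =
        inj₁ record { P = P₀ ; A = A ; B = B ; C = C ; Q = Q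
                    ; eqn = trans eqn (cong (λ l → P₀ ++ a ∷ l) (++-assoc A (b ∷ B) (c ∷ C ++ d ∷ Q)))
                    ; va = va ; vb = vb ; va′ = vc ; vb′ = vd }
    -- Three passages of v would exceed the total of two.
    find (suc (suc (suc m))) e | _ with trans (sym total) (cong (λ k → V.cnt v (wd P₀) + (k + V.cnt v (wd Q₀))) e)
    ... | e′ with trans e′ (trans (+-suc (V.cnt v (wd P₀)) _) (cong suc (trans (+-suc (V.cnt v (wd P₀)) _) (cong suc (+-suc (V.cnt v (wd P₀)) _)))))
    ...   | ()

  both : Fin n → Fin n → Fin n → Bool
  both u v x = V.eq u x ∨ V.eq v x

  -- S is kept abstract, with its members u and v only characterised, so that the same switching set
  -- `both u v` serves for crossings in either order.
  module PivotMove {τ L G u v} (rep : Represents τ L G) (bu : black G u ≡ true) (bv : black G v ≡ true)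
    (uv : adj G u v ≡ true) (vu : adj G v u ≡ true) (cr : Crossing u v L) (S : Fin n → Bool)
    (Su : S u ≡ true) (Sv : S v ≡ true) (S-only : ∀ {x} → x ≢ u → x ≢ v → S x ≡ false) where
    private
      open Represents rep
      open Crossing cr
      open Pivot G u v loopless uv vu
      τ′ : HE n → HE n
      τ′ = flip S τ
      M₁ M₂ M₃ N L′ : List (HE n)
      M₁ = a ∷ A
      M₂ = b ∷ B
      M₃ = a′ ∷ C
      N  = b′ ∷ Q
      L′ = P ++ M₃ ++ M₂ ++ M₁ ++ N

      pu : Passages u L
      pu = passages-at P a (A ++ b ∷ B) (trans eqn (cong (λ l → P ++ a ∷ l) (sym (++-assoc A (b ∷ B) _)))) va va′ (twice u)
      pv : Passages v L
      pv = passages-at (P ++ a ∷ A) b (B ++ a′ ∷ C)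
        (trans eqn (trans (sym (++-assoc P (a ∷ A) _)) (cong (λ l → (P ++ a ∷ A) ++ b ∷ l) (sym (++-assoc B (a′ ∷ C) _)))))
        vb vb′ (twice v)
      module pu = Passages pu
      module pv = Passages pv

      twist-at : ∀ {h x} → vert h ≡ x → S x ≡ true → twist S h ≡ T̂ h
      twist-at e s = twist-true {S} (trans (cong S e) s)

      Ta≡a′ : twist S a ≡ a′
      Ta≡a′ = trans (twist-at va Su) (black-passages pu bu)
      Ta′≡a : twist S a′ ≡ a
      Ta′≡a = trans (twist-at va′ Su) (trans (cong T̂ (sym (black-passages pu bu))) (T̂-inv a))
      Tb≡b′ : twist S b ≡ b′
      Tb≡b′ = trans (twist-at vb Sv) (black-passages pv bv)
      Tb′≡b : twist S b′ ≡ b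
      Tb′≡b = trans (twist-at vb′ Sv) (trans (cong T̂ (sym (black-passages pv bv))) (T̂-inv b))

      fixes : ∀ {k Lu Lv} → V.cnt u (wd Lu) ≡ 0 → V.cnt v (wd Lv) ≡ 0 → k ∈ Lu → k ∈ Lv → twist S k ≡ k
      fixes eu ev ku kv = twist-false {S} (S-only (avoids eu ku) (avoids ev kv))

      fix-P : ∀ {k} → k ∈ P → twist S k ≡ k
      fix-P i = fixes pu.xP pv.xP i (∈-++⁺ˡ i)
      fix-A : ∀ {k} → k ∈ A → twist S k ≡ k
      fix-A i = fixes pu.xA pv.xP (∈-++⁺ˡ i) (∈-++⁺ʳ P (there i))
      fix-B : ∀ {k} → k ∈ B → twist S k ≡ k
      fix-B i = fixes pu.xA pv.xA (∈-++⁺ʳ A (there i)) (∈-++⁺ˡ i)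
      fix-C : ∀ {k} → k ∈ C → twist S k ≡ k
      fix-C i = fixes pu.xQ pv.xA (∈-++⁺ˡ i) (∈-++⁺ʳ B (there i))
      fix-Q : ∀ {k} → k ∈ Q → twist S k ≡ k
      fix-Q i = fixes pu.xQ pv.xQ (∈-++⁺ʳ C (there i)) i

      segments : Seg τ P a × Seg τ M₁ b × Seg τ M₂ a′ × Seg τ M₃ b′ × Seg τ N (first P a)
      segments with closed-++⁻ P (subst (Closed τ) eqn closed)
      ... | s , s₁ with seg-++⁻ M₁ s₁
      ...   | t₁ , s₂ with seg-++⁻ M₂ s₂
      ...     | t₂ , s₃ with seg-++⁻ M₃ s₃
      ...       | t₃ , s₄ = s , t₁ , t₂ , t₃ , s₄

      -- As u and v are black, `twist S` exchanges a with a′ and b with b′. Every block keeps its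
      -- direction and merely continues differently: P into `M₃`, then `M₂`, `M₁` and N.
      closed′ : Closed τ′ L′
      closed′ with segments
      ... | s , s₁ , s₂ , s₃ , s₄ = closed-++⁺ P (λ _ → refl)
        (subst (Seg τ′ P) Ta≡a′ (seg-∘′ _ P fix-P s))
        (seg-++⁺ M₃ (subst (Seg τ′ M₃) Tb′≡b (seg-∘ _ a′ C fix-C s₃))
        (seg-++⁺ M₂ (subst (Seg τ′ M₂) Ta′≡a (seg-∘ _ b B fix-B s₂))
        (seg-++⁺ M₁ (subst (Seg τ′ M₁) Tb≡b′ (seg-∘ _ a A fix-A s₁))
          (subst (Seg τ′ N) (trans (first-∘ _ P fix-P) (cong (first P) Ta≡a′)) (seg-∘ _ b′ Q fix-Q s₄)))))

      cnt-same : ∀ h → H.cnt h L′ ≡ H.cnt h L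
      cnt-same h = begin
        H.cnt h L′
          ≡⟨ expand M₃ M₂ M₁ ⟩
        H.cnt h P + (H.cnt h M₃ + (H.cnt h M₂ + (H.cnt h M₁ + H.cnt h N)))
          ≡⟨ solve 5 (λ p x y z q → p :+ (z :+ (y :+ (x :+ q))) := p :+ (x :+ (y :+ (z :+ q)))) refl
               (H.cnt h P) (H.cnt h M₁) (H.cnt h M₂) (H.cnt h M₃) (H.cnt h N) ⟩
        H.cnt h P + (H.cnt h M₁ + (H.cnt h M₂ + (H.cnt h M₃ + H.cnt h N)))
          ≡⟨ sym (expand M₁ M₂ M₃) ⟩
        H.cnt h (P ++ M₁ ++ M₂ ++ M₃ ++ N)
          ≡⟨ cong (H.cnt h) (sym eqn) ⟩
        H.cnt h L ∎
        where
        open ≡-Reasoning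
        open ℕ-Solver.+-*-Solver
        expand : ∀ X Y Z → H.cnt h (P ++ X ++ Y ++ Z ++ N) ≡
          H.cnt h P + (H.cnt h X + (H.cnt h Y + (H.cnt h Z + H.cnt h N)))
        expand X Y Z = trans (H.cnt-++ h P _) (cong (H.cnt h P +_) (trans (H.cnt-++ h X _)
          (cong (H.cnt h X +_) (trans (H.cnt-++ h Y _) (cong (H.cnt h Y +_) (H.cnt-++ h Z N))))))

      word : ∀ X Y Z → wd (P ++ X ++ Y ++ Z ++ N) ≡ wd P ++ wd X ++ wd Y ++ wd Z ++ wd N
      word X Y Z = trans (map-++ vert P _) (cong (wd P ++_) (trans (map-++ vert X _)
        (cong (wd X ++_) (trans (map-++ vert Y _) (cong (wd Y ++_) (map-++ vert Z N))))))

      nbhd-u : ∀ x → nbhd u x ≡ V.par x (wd M₁ ++ wd M₂)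
      nbhd-u x = trans (cong₂ _xor_ (adj-passages pu x) (cong (V.eq x) (sym va)))
        (trans (xor-comm _ (V.eq x (vert a))) (trans (sym (V.par-∷ x (vert a) (wd (A ++ b ∷ B))))
          (cong (λ l → V.par x (vert a ∷ l)) (map-++ vert A (b ∷ B)))))

      nbhd-v : ∀ x → nbhd v x ≡ V.par x (wd M₂ ++ wd M₃)
      nbhd-v x = trans (cong₂ _xor_ (adj-passages pv x) (cong (V.eq x) (sym vb)))
        (trans (xor-comm _ (V.eq x (vert b))) (trans (sym (V.par-∷ x (vert b) (wd (B ++ a′ ∷ C))))
          (cong (λ l → V.par x (vert b ∷ l)) (map-++ vert B (a′ ∷ C)))))

      inter-L′ : ∀ {x y} → x ≢ y → V.inter x y (wd L′) ≡
        adj G x y xor ((nbhd u x ∧ nbhd v y) xor (nbhd v x ∧ nbhd u y))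
      inter-L′ {x} {y} ne = begin
        V.inter x y (wd L′)
          ≡⟨ cong (V.inter x y) (word M₃ M₂ M₁) ⟩
        V.inter x y (wd P ++ wd M₃ ++ wd M₂ ++ wd M₁ ++ wd N)
          ≡⟨ V.inter-exchange x y (wd P) (wd M₁) (wd M₂) (wd M₃) (wd N) ⟩
        V.inter x y (wd P ++ wd M₁ ++ wd M₂ ++ wd M₃ ++ wd N) xor
          ((V.par x (wd M₁ ++ wd M₂) ∧ V.par y (wd M₂ ++ wd M₃)) xor
           (V.par x (wd M₂ ++ wd M₃) ∧ V.par y (wd M₁ ++ wd M₂)))
          ≡⟨ cong₂ _xor_
               (sym (trans (adjacent ne) (cong (V.inter x y) (trans (cong wd eqn) (word M₁ M₂ M₃)))))
               (sym (cong₂ _xor_ (cong₂ _∧_ (nbhd-u x) (nbhd-v y)) (cong₂ _∧_ (nbhd-v x) (nbhd-u y)))) ⟩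
        adj G x y xor ((nbhd u x ∧ nbhd v y) xor (nbhd v x ∧ nbhd u y)) ∎
        where open ≡-Reasoning

      tour′ : Tour τ′ L′
      tour′ = record
        { sys    = flip-system S sys
        ; closed = closed′
        ; euler  = λ h → trans (cong₂ _+_ (cnt-same h) (cnt-same (σ Γ h))) (euler h)
        }

      -- No dart is reversed, so no colour changes.
      colour′ : ∀ h → H.par (T̂ h) L′ xor H.par h L′ ≡ not (black G (vert h))
      colour′ h = trans (cong₂ (λ m k → odd m xor odd k) (cnt-same (T̂ h)) (cnt-same h)) (colour h)

    represents-uvu : Represents τ′ L′ G₃
    represents-uvu = record
      { tour     = tour′
      ; adjacent = λ ne → trans (pivot-adj ne) (sym (inter-L′ ne))
      ; loopless = pivot-loopless
      ; colour   = λ h → trans (colour′ h) (cong not (sym (pivot-black bu bv (vert h))))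
      }

    represents-vuv : Represents τ′ L′ (Pivot.G₃ G v u loopless vu uv)
    represents-vuv = record
      { tour     = tour′
      ; adjacent = λ {x} {y} ne → trans (Pivot.pivot-adj G v u loopless vu uv ne) (sym (trans (inter-L′ ne)
                     (cong (adj G x y xor_) (xor-comm (nbhd u x ∧ nbhd v y) _))))
      ; loopless = Pivot.pivot-loopless G v u loopless vu uv
      ; colour   = λ h → trans (colour′ h) (cong not (sym (Pivot.pivot-black G v u loopless vu uv bv bu (vert h))))
      }

  pivot-move : ∀ {τ L G u v} → Represents τ L G → adj G u v ≡ true → black G u ≡ true → black G v ≡ true →
    (∃ λ L′ → Represents (flip (both u v) τ) L′ (lc (lc (lc G u) v) u)) ×
    (∃ λ L′ → Represents (flip (both u v) τ) L′ (lc (lc (lc G v) u) v))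
  pivot-move {G = G} {u} {v} rep uv bu bv = moves (crossing rep uv)
    where
    vu : adj G v u ≡ true
    vu = trans (Represents.adj-sym rep v u) uv
    Su : both u v u ≡ true
    Su rewrite V.eq-true (refl {x = u}) = refl
    Sv : both u v v ≡ true
    Sv rewrite V.eq-true (refl {x = v}) = ∨-zeroʳ (V.eq u v)
    S-only : ∀ {x} → x ≢ u → x ≢ v → both u v x ≡ false
    S-only xu xv rewrite V.eq-false (≢-sym xu) | V.eq-false (≢-sym xv) = refl
    moves : Crossing u v _ ⊎ Crossing v u _ → _
    moves (inj₁ cr) = (_ , M.represents-uvu) , (_ , M.represents-vuv)
      where module M = PivotMove rep bu bv uv vu cr (both u v) Su Sv S-only
    moves (inj₂ cr) = (_ , M.represents-vuv) , (_ , M.represents-uvu)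
      where module M = PivotMove rep bv bu vu uv cr (both u v) Sv Su (λ xv xu → S-only xu xv)

  -- Cutting a closed trail at non-interlacing vertices.

  closed-∘ : ∀ {τ} t L → (∀ {k} → k ∈ L → t k ≡ k) → Closed τ L → Closed (t ∘ τ) L
  closed-∘ t L f (c , s , e) = t c , seg-∘′ t L f s , trans (sym (first-∘ t L f)) (cong t e)

  cnt-part : ∀ z {K} Ks → K ∈ Ks → V.cnt z (wd K) ≤ V.cnt z (wd (concat Ks))
  cnt-part z (K ∷ Ks) i rewrite map-++ vert K (concat Ks) | V.cnt-++ z (wd K) (wd (concat Ks)) with i
  ... | here refl = m≤m+n _ _
  ... | there j   = ≤-trans (cnt-part z Ks j) (m≤n+m _ _)

  -- L is closed under τ, and τ′ arises from τ by switching at the vertices xs, each of which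
  -- L passes twice or not at all, in pairwise non-interlacing fashion.
  record Splittable (τ τ′ : HE n → HE n) (xs : List (Fin n)) (L : List (HE n)) : Set where
    field
      sys       : System τ
      closed    : Closed τ L
      nonempty  : L ≢ []
      switched  : ∀ h → vert h ∈ xs → τ′ h ≡ T̂ (τ h)
      unchanged : ∀ h → ¬ (vert h ∈ xs) → τ′ h ≡ τ h
      mates     : ∀ {a b} → a ∈ L → b ∈ L → vert a ≡ vert b → vert a ∈ xs → a ≢ b → T̂ a ≡ b
      simple    : ∀ h → H.cnt h L ≤ 1
      at-most-2 : ∀ z → V.cnt z (wd L) ≤ 2
      even      : ∀ {x} → x ∈ xs → V.par x (wd L) ≡ false
      nested    : ∀ {x y} → x ∈ xs → y ∈ xs → x ≢ y → V.inter x y (wd L) ≡ false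

  -- The last two fields are the two directions of one criterion. `separated` shows that the parts
  -- cut along an anticlique are cycles; `together` shows that the set read off from a decomposition
  -- is maximal.
  record Parts (τ′ : HE n → HE n) (xs : List (Fin n)) (L : List (HE n)) : Set where
    field
      parts     : List (List (HE n))
      cnt-ends  : ∀ h → H.cnt h (concat parts) ≡ H.cnt h L
      cnt-verts : ∀ z → V.cnt z (wd (concat parts)) ≡ V.cnt z (wd L)
      closed    : ∀ {K} → K ∈ parts → Closed τ′ K
      nonempty  : ∀ {K} → K ∈ parts → K ≢ []
      separated : ∀ {K z} → K ∈ parts → V.cnt z (wd K) ≡ 2 →
                  ¬ (z ∈ xs) × (∀ {x} → x ∈ xs → V.inter x z (wd L) ≡ false)
      together  : ∀ {z} → V.cnt z (wd L) ≡ 2 → ¬ (z ∈ xs) → (∀ {x} → x ∈ xs → V.inter x z (wd L) ≡ false) →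
                  ∃ λ K → K ∈ parts × V.cnt z (wd K) ≡ 2

  even-cases : ∀ m → m ≤ 2 → odd m ≡ false → m ≡ 0 ⊎ m ≡ 2
  even-cases 0 _ _ = inj₁ refl
  even-cases 2 _ _ = inj₂ refl
  even-cases (suc (suc (suc m))) (s≤s (s≤s ())) _

  2≤⇒2 : ∀ {m} → 2 ≤ m → m ≤ 2 → m ≡ 2
  2≤⇒2 p q = ≤-antisym q p

  -- Switching L at x cuts it into the two closed trails K and K′.
  record Half (x : Fin n) (L K K′ : List (HE n)) : Set where
    field
      ⊆L        : ∀ {k} → k ∈ K → k ∈ L
      cnt-ends  : ∀ h → H.cnt h L ≡ H.cnt h K + H.cnt h K′
      cnt-verts : ∀ z → V.cnt z (wd L) ≡ V.cnt z (wd K) + V.cnt z (wd K′)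
      once      : V.cnt x (wd K) ≡ 1
      halves    : ∀ {y z} → V.par y (wd L) ≡ false → V.par z (wd L) ≡ false →
                  V.par y (wd K) ≡ false → V.par z (wd K) ≡ false →
                  V.inter y z (wd L) ≡ V.inter y z (wd K) xor V.inter y z (wd K′)
      side      : ∀ {z} → x ≢ z → V.par z (wd L) ≡ false → V.inter x z (wd L) ≡ V.par z (wd K)

  module _ {x xs L K K′} (half : Half x L K K′) (le : ∀ z → V.cnt z (wd L) ≤ 2)
    (ev : ∀ {y} → y ∈ x ∷ xs → V.par y (wd L) ≡ false)
    (nc : ∀ {y z} → y ∈ x ∷ xs → z ∈ x ∷ xs → y ≢ z → V.inter y z (wd L) ≡ false) (x∉xs : ¬ (x ∈ xs)) where
    open Half half

    half≤ : ∀ z → V.cnt z (wd K) ≤ V.cnt z (wd L)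
    half≤ z = ≤-trans (m≤m+n _ _) (≤-reflexive (sym (cnt-verts z)))

    half-≢ : ∀ {y} → y ∈ xs → x ≢ y
    half-≢ y∈ refl = x∉xs y∈

    -- Since x and y do not interlace, an even number of passages of y falls into each half.
    half-even : ∀ {y} → y ∈ xs → V.par y (wd K) ≡ false
    half-even y∈ = trans (sym (side (half-≢ y∈) (ev (there y∈)))) (nc (here refl) (there y∈) (half-≢ y∈))

    half-2 : ∀ {z} → V.cnt z (wd K) ≡ 2 → V.cnt z (wd L) ≡ 2 × V.cnt z (wd K′) ≡ 0
    half-2 {z} e = L2 , +-cancelˡ-≡ 2 _ _ (trans (cong (_+ V.cnt z (wd K′)) (sym e)) (trans (sym (cnt-verts z)) L2))
      where
      L2 : V.cnt z (wd L) ≡ 2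
      L2 = 2≤⇒2 (≤-trans (≤-reflexive (sym e)) (half≤ z)) (le z)

    half-inter : ∀ {y z} → y ∈ xs → V.cnt z (wd K) ≡ 2 → V.inter y z (wd L) ≡ V.inter y z (wd K)
    half-inter {y} {z} y∈ e = trans
      (halves (ev (there y∈)) (cong odd (proj₁ (half-2 {z} e))) (half-even y∈) (cong odd e))
      (trans (cong (V.inter y z (wd K) xor_) (V.inter-noʳ y (wd K′) (proj₂ (half-2 {z} e)))) (xor-identityʳ _))

    half-nested : ∀ {y z} → y ∈ xs → z ∈ xs → y ≢ z → V.inter y z (wd K) ≡ false
    half-nested {y} {z} y∈ z∈ ne with even-cases _ (≤-trans (half≤ z) (le z)) (half-even z∈)
    ... | inj₁ e = V.inter-noʳ y (wd K) e
    ... | inj₂ e = trans (sym (half-inter y∈ e)) (nc (there y∈) (there z∈) ne)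

    half-separated : ∀ {z} → V.cnt z (wd K) ≡ 2 → ¬ (z ∈ xs) × (∀ {y} → y ∈ xs → V.inter y z (wd K) ≡ false) →
      ¬ (z ∈ x ∷ xs) × (∀ {y} → y ∈ x ∷ xs → V.inter y z (wd L) ≡ false)
    half-separated {z} e (z∉ , noi) = z∉′ , noi′
      where
      x≢z : x ≢ z
      x≢z refl with trans (sym once) e
      ... | ()
      z∉′ : ¬ (z ∈ x ∷ xs)
      z∉′ (here p)  = x≢z (sym p)
      z∉′ (there i) = z∉ i
      noi′ : ∀ {y} → y ∈ x ∷ xs → V.inter y z (wd L) ≡ false
      noi′ (here refl) = trans (side x≢z (cong odd (proj₁ (half-2 {z} e)))) (cong odd e)
      noi′ (there i)   = trans (half-inter i e) (noi i)

    half-splittable : ∀ {τ τ₁ τ′} → Splittable τ τ′ (x ∷ xs) L → System τ₁ → Closed τ₁ K → K ≢ [] →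
      (∀ h → vert h ∈ xs → τ′ h ≡ T̂ (τ₁ h)) → (∀ h → ¬ (vert h ∈ xs) → τ′ h ≡ τ₁ h) → Splittable τ₁ τ′ xs K
    half-splittable sp sys₁ cl ne sw un = record
      { sys = sys₁ ; closed = cl ; nonempty = ne ; switched = sw ; unchanged = un
      ; mates     = λ a∈ b∈ e x∈ → Splittable.mates sp (⊆L a∈) (⊆L b∈) e (there x∈)
      ; simple    = λ h → ≤-trans (≤-trans (m≤m+n _ _) (≤-reflexive (sym (cnt-ends h)))) (Splittable.simple sp h)
      ; at-most-2 = λ z → ≤-trans (half≤ z) (le z)
      ; even      = half-even
      ; nested    = half-nested
      }

  merge : ∀ {τ′ x xs L K K′} → Half x L K K′ → Half x L K′ K → (∀ z → V.cnt z (wd L) ≤ 2) →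
    (∀ {y} → y ∈ x ∷ xs → V.par y (wd L) ≡ false) →
    (∀ {y z} → y ∈ x ∷ xs → z ∈ x ∷ xs → y ≢ z → V.inter y z (wd L) ≡ false) → ¬ (x ∈ xs) →
    Parts τ′ xs K → Parts τ′ xs K′ → Parts τ′ (x ∷ xs) L
  merge {τ′} {x} {xs} {L} {K} {K′} half half′ le ev nc x∉xs ps ps′ = record
    { parts     = P.parts ++ P′.parts
    ; cnt-ends  = λ h → trans (cong (H.cnt h) (sym (concat-++ P.parts P′.parts)))
                    (trans (H.cnt-++ h (concat P.parts) (concat P′.parts))
                      (trans (cong₂ _+_ (P.cnt-ends h) (P′.cnt-ends h)) (sym (Half.cnt-ends half h))))
    ; cnt-verts = λ z → trans (cong (V.cnt z ∘ wd) (sym (concat-++ P.parts P′.parts)))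
                    (trans (cong (V.cnt z) (map-++ vert (concat P.parts) (concat P′.parts)))
                      (trans (V.cnt-++ z (wd (concat P.parts)) (wd (concat P′.parts)))
                        (trans (cong₂ _+_ (P.cnt-verts z) (P′.cnt-verts z)) (sym (Half.cnt-verts half z)))))
    ; closed    = [ P.closed , P′.closed ]′ ∘ ∈-++⁻ P.parts
    ; nonempty  = [ P.nonempty , P′.nonempty ]′ ∘ ∈-++⁻ P.parts
    ; separated = λ {K₁} {z} i e → [ (λ j → half-separated half le ev nc x∉xs (in-half half ps j e) (P.separated j e))
                                   , (λ j → half-separated half′ le ev nc x∉xs (in-half half′ ps′ j e) (P′.separated j e))
                                   ]′ (∈-++⁻ P.parts i)
    ; together  = together
    }
    where
    module P = Parts ps
    module P′ = Parts ps′
    in-half : ∀ {K₀ K₀′} → Half x L K₀ K₀′ → (qs : Parts τ′ xs K₀) → ∀ {K₁ z} → K₁ ∈ Parts.parts qs →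
      V.cnt z (wd K₁) ≡ 2 → V.cnt z (wd K₀) ≡ 2
    in-half hf qs {z = z} i e = 2≤⇒2
      (≤-trans (≤-reflexive (sym e)) (≤-trans (cnt-part z (Parts.parts qs) i) (≤-reflexive (Parts.cnt-verts qs z))))
      (≤-trans (half≤ hf le ev nc x∉xs z) (le z))
    -- As z does not interlace with x, both its passages lie in the same half, and the induction
    -- hypothesis for that half applies.
    together : ∀ {z} → V.cnt z (wd L) ≡ 2 → ¬ (z ∈ x ∷ xs) → (∀ {y} → y ∈ x ∷ xs → V.inter y z (wd L) ≡ false) →
      ∃ λ K₁ → K₁ ∈ P.parts ++ P′.parts × V.cnt z (wd K₁) ≡ 2
    together {z} e z∉ noi with even-cases (V.cnt z (wd K)) (≤-trans (half≤ half le ev nc x∉xs z) (le z))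
           (trans (sym (Half.side half (λ p → z∉ (here (sym p))) (cong odd e))) (noi (here refl)))
    ... | inj₂ K2 with P.together K2 (z∉ ∘ there)
                         (λ i → trans (sym (half-inter half le ev nc x∉xs i K2)) (noi (there i)))
    ...   | K₁ , i , e₁ = K₁ , ∈-++⁺ˡ i , e₁
    together {z} e z∉ noi | inj₁ K0 with P′.together K′2 (z∉ ∘ there)
                         (λ i → trans (sym (half-inter half′ le ev nc x∉xs i K′2)) (noi (there i)))
      where
      K′2 : V.cnt z (wd K′) ≡ 2
      K′2 = trans (cong (_+ V.cnt z (wd K′)) (sym K0)) (trans (sym (Half.cnt-verts half z)) e)
    ...   | K₁ , i , e₁ = K₁ , ∈-++⁺ʳ P.parts i , e₁

  module _ {x L} (p : Passages x L) (xx : V.cnt x (wd L) ≡ 2) where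
    open Passages p
    private
      M R : List (HE n)
      M = a ∷ A
      R = P ++ b ∷ Q
      wordL : wd L ≡ wd P ++ wd M ++ wd (b ∷ Q)
      wordL = trans (cong wd eqn) (trans (map-++ vert P _) (cong (wd P ++_) (map-++ vert M (b ∷ Q))))
      wordR : wd R ≡ wd P ++ wd (b ∷ Q)
      wordR = map-++ vert P (b ∷ Q)

    halves-cnt-ends : ∀ h → H.cnt h L ≡ H.cnt h M + H.cnt h R
    halves-cnt-ends h = trans (trans (cong (H.cnt h) eqn)
        (trans (H.cnt-++ h P _) (cong (H.cnt h P +_) (H.cnt-++ h M (b ∷ Q)))))
      (trans (solve 3 (λ p m q → p :+ (m :+ q) := m :+ (p :+ q)) refl (H.cnt h P) (H.cnt h M) (H.cnt h (b ∷ Q)))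
        (cong (H.cnt h M +_) (sym (H.cnt-++ h P (b ∷ Q)))))
      where open ℕ-Solver.+-*-Solver

    halves-cnt-verts : ∀ z → V.cnt z (wd L) ≡ V.cnt z (wd M) + V.cnt z (wd R)
    halves-cnt-verts z = trans (trans (cong (V.cnt z) wordL)
        (trans (V.cnt-++ z (wd P) _) (cong (V.cnt z (wd P) +_) (V.cnt-++ z (wd M) (wd (b ∷ Q))))))
      (trans (solve 3 (λ p m q → p :+ (m :+ q) := m :+ (p :+ q)) refl (V.cnt z (wd P)) (V.cnt z (wd M))
          (V.cnt z (wd (b ∷ Q))))
        (cong (V.cnt z (wd M) +_) (sym (trans (cong (V.cnt z) wordR) (V.cnt-++ z (wd P) (wd (b ∷ Q)))))))
      where open ℕ-Solver.+-*-Solver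

    private
      onceM : V.cnt x (wd M) ≡ 1
      onceM = trans (V.cnt-here (wd A) (sym va)) (cong suc xA)
      onceR : V.cnt x (wd R) ≡ 1
      onceR = +-cancelˡ-≡ 1 _ _ (trans (cong (_+ V.cnt x (wd R)) (sym onceM)) (trans (sym (halves-cnt-verts x)) xx))

      nestedM : ∀ {y z} → V.par y (wd M) ≡ false → V.par z (wd M) ≡ false →
        V.inter y z (wd L) ≡ V.inter y z (wd M) xor V.inter y z (wd R)
      nestedM {y} {z} ym zm = trans (cong (V.inter y z) wordL)
        (trans (V.inter-nested (wd P) (wd M) (wd (b ∷ Q)) ym zm)
            (cong (λ l → V.inter y z (wd M) xor V.inter y z l) (sym wordR)))

      sideM : ∀ {z} → x ≢ z → V.inter x z (wd L) ≡ V.par z (wd M)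
      sideM {z} ne = trans (cong (V.inter x z) (trans wordL (cong₂ (λ u v → wd P ++ u ∷ wd A ++ v ∷ wd Q) va vb)))
        (trans (V.inter-passages (wd P) (wd A) (wd Q) ne xP xA xQ)
          (cong odd (sym (V.cnt-there (wd A) (λ e → ne (sym (trans e va)))))))

      parM : ∀ {z} → V.par z (wd L) ≡ false → V.par z (wd M) ≡ V.par z (wd R)
      parM {z} e = xor-false _ _ (trans (sym (odd-+ (V.cnt z (wd M)) _)) (trans (cong odd (sym (halves-cnt-verts z))) e))
        where
        xor-false : ∀ a b → a xor b ≡ false → a ≡ b
        xor-false true  true  _ = refl
        xor-false false false _ = refl

    half-inside : Half x L M R
    half-inside = record
      { ⊆L        = λ i → subst (_ ∈_) (sym eqn) (∈-++⁺ʳ P (∈-++⁺ˡ i))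
      ; cnt-ends  = halves-cnt-ends
      ; cnt-verts = halves-cnt-verts
      ; once      = onceM
      ; halves    = λ _ _ → nestedM
      ; side      = λ ne _ → sideM ne
      }

    half-outside : Half x L R M
    half-outside = record
      { ⊆L        = λ i → subst (_ ∈_) (sym eqn) ([ ∈-++⁺ˡ , (λ j → ∈-++⁺ʳ P (∈-++⁺ʳ M j)) ]′ (∈-++⁻ P i))
      ; cnt-ends  = λ h → trans (halves-cnt-ends h) (+-comm (H.cnt h M) _)
      ; cnt-verts = λ z → trans (halves-cnt-verts z) (+-comm (V.cnt z (wd M)) _)
      ; once      = onceR
      ; halves    = λ {y} {z} yl zl yr zr → trans (nestedM (trans (parM {y} yl) yr) (trans (parM {z} zl) zr))
          (xor-comm (V.inter y z (wd M)) _)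
      ; side      = λ {z} ne zl → trans (sideM ne) (parM {z} zl)
      }

    -- The switch sends the exit b of the inner block back to its start a, and lets P skip this
    -- block by going on with b.
    closed-halves : ∀ {τ} → T̂ a ≡ b → Closed τ L → Closed (flip (V.eq x) τ) M × Closed (flip (V.eq x) τ) R
    closed-halves {τ} Ta≡b cl with closed-passages P a A (subst (Closed τ) eqn cl)
    ... | s , s₁ , s₂ =
        (a , subst (Seg τ₁ M) (trans (twist-x vb) (trans (cong T̂ (sym Ta≡b)) (T̂-inv a)))
            (seg-∘ _ a A (flip-fixes xA) s₁) , refl)
      , closed-++⁺ P (λ _ → refl)
          (subst (Seg τ₁ P) (trans (twist-x va) Ta≡b) (seg-∘′ _ P (flip-fixes xP) s))
          (subst (Seg τ₁ (b ∷ Q)) (trans (first-∘ _ P (flip-fixes xP)) (cong (first P) (trans (twist-x va) Ta≡b)))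
            (seg-∘ _ b Q (flip-fixes xQ) s₂))
      where
      τ₁ : HE n → HE n
      τ₁ = flip (V.eq x) τ
      twist-x : ∀ {h} → vert h ≡ x → twist (V.eq x) h ≡ T̂ h
      twist-x e = twist-true {V.eq x} (V.eq-true (sym e))

  -- Cutting at x leaves every other switching vertex with zero or two passages in each half, still
  -- without interlacing, so both halves satisfy the hypotheses for `xs`. A half may miss later
  -- vertices altogether; then the switch changes the system but not the list.
  decompose : ∀ {τ τ′} xs {L} → Unique xs → Splittable τ τ′ xs L → Parts τ′ xs L
  decompose [] {L} _ sp = record
    { parts     = L ∷ []
    ; cnt-ends  = λ h → cong (H.cnt h) (++-identityʳ L)
    ; cnt-verts = λ z → cong (V.cnt z ∘ wd) (++-identityʳ L)
    ; closed    = λ { (here refl) → proj₁ closed , seg-cong L (λ h → sym (unchanged h λ ())) (proj₁ (proj₂ closed)) , proj₂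
        (proj₂ closed) }
    ; nonempty  = λ { (here refl) → nonempty }
    ; separated = λ _ _ → (λ ()) , λ ()
    ; together  = λ e _ _ → L , here refl , e
    }
    where open Splittable sp
  decompose {τ} {τ′} (x ∷ xs) {L} (x∉ ∷ u) sp = by-count (even-cases _ (at-most-2 x) (even (here refl)))
    where
    open Splittable sp
    x∉xs : ¬ (x ∈ xs)
    x∉xs i = All.lookup x∉ i refl
    τ₁ : HE n → HE n
    τ₁ = flip (V.eq x) τ
    sys₁ : System τ₁
    sys₁ = flip-system (V.eq x) sys
    switched₁ : ∀ h → vert h ∈ xs → τ′ h ≡ T̂ (τ₁ h)
    switched₁ h i = trans (switched h (there i)) (cong T̂ (sym (flip-false {V.eq x} sys (V.eq-false λ { refl → x∉xs i }))))
    unchanged₁ : ∀ h → ¬ (vert h ∈ xs) → τ′ h ≡ τ₁ h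
    unchanged₁ h ¬i with x Fin.≟ vert h
    ... | yes e = trans (switched h (here (sym e))) (sym (flip-true {V.eq x} sys (V.eq-true e)))
    ... | no ne = trans (unchanged h (λ { (here p) → ne (sym p) ; (there i) → ¬i i })) (sym (flip-false {V.eq x} sys (V.eq-false ne)))

    by-count : V.cnt x (wd L) ≡ 0 ⊎ V.cnt x (wd L) ≡ 2 → Parts τ′ (x ∷ xs) L
    by-count (inj₁ x0) = record
      { parts     = parts
      ; cnt-ends  = cnt-ends
      ; cnt-verts = cnt-verts
      ; closed    = Parts.closed ps
      ; nonempty  = Parts.nonempty ps
      ; separated = λ {K} {z} i e → (λ { (here refl) → absent i e ; (there j) → proj₁ (separated i e) j })
                                  , λ { (here refl) → V.inter-noˡ z (wd L) x0 ; (there j) → proj₂ (separated i e) j }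
      ; together  = λ e z∉ noi → together e (z∉ ∘ there) (noi ∘ there)
      }
      where
      ps : Parts τ′ xs L
      ps = decompose xs u record
        { sys = sys₁ ; closed = closed-∘ _ L (flip-fixes x0) closed ; nonempty = nonempty
        ; switched = switched₁ ; unchanged = unchanged₁
        ; mates = λ a∈ b∈ e i → mates a∈ b∈ e (there i) ; simple = simple ; at-most-2 = at-most-2
        ; even = even ∘ there ; nested = λ i j → nested (there i) (there j) }
      open Parts ps using (parts; cnt-ends; cnt-verts; separated; together)
      absent : ∀ {K} → K ∈ parts → V.cnt x (wd K) ≡ 2 → ⊥
      absent i e with ≤-trans (≤-reflexive (sym e)) (≤-trans (cnt-part x parts i) (≤-reflexive (trans (cnt-verts x) x0)))
      ... | ()
    by-count (inj₂ x2) = merge (half-inside p x2) (half-outside p x2) at-most-2 even nested x∉xs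
      (decompose xs u (half-splittable (half-inside p x2) at-most-2 even nested x∉xs sp sys₁ (proj₁ cls)
          (λ ()) switched₁ unchanged₁))
      (decompose xs u (half-splittable (half-outside p x2) at-most-2 even nested x∉xs sp sys₁
          (proj₂ cls) R≢[] switched₁ unchanged₁))
      where
      p : Passages x L
      p = passages x L x2
      open Passages p
      Ta≡b : T̂ a ≡ b
      Ta≡b = mates a∈ b∈ (trans va (sym vb)) (here va) (passages-≢ p (simple a))
      cls : Closed τ₁ (a ∷ A) × Closed τ₁ (P ++ b ∷ Q)
      cls = closed-halves p x2 Ta≡b closed
      R≢[] : P ++ b ∷ Q ≢ []
      R≢[] e with P
      R≢[] () | []
      R≢[] () | _ ∷ _

  -- From lists of darts to indexed trails, and transitions of families of trails.

  seg-lookup : ∀ {τ} a K {c} → Seg τ (a ∷ K) c → ∀ k →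
    τ (σ Γ (lookup (a ∷ K) k)) ≡ maybe (lookup (a ∷ K)) c (sucMaybe k)
  seg-lookup a []      (p , _) zero = p
  seg-lookup a (b ∷ K) (p , s) zero = p
  seg-lookup a (b ∷ K) (p , s) (suc k) with sucMaybe k | seg-lookup b K s k
  ... | just _  | e = e
  ... | nothing | e = e

  seg-tabulate : ∀ {τ m c} (f : Fin (suc m) → HE n) → (∀ k → τ (σ Γ (f k)) ≡ maybe f c (sucMaybe k)) → Seg τ (tabulate f) c
  seg-tabulate {m = zero}  f e = e zero , tt
  seg-tabulate {m = suc m} f e = e zero , seg-tabulate (f ∘ suc) λ k → trans (e (suc k)) (maybe-map (sucMaybe k))
    where
    maybe-map : ∀ x → maybe f _ (Maybe.map suc x) ≡ maybe (f ∘ suc) _ x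
    maybe-map (just _) = refl
    maybe-map nothing  = refl

  next-maybe : ∀ {m} {A : Set} (f : Fin (suc m) → A) k → f (next k) ≡ maybe f (f zero) (sucMaybe k)
  next-maybe f k with sucMaybe k
  ... | just _  = refl
  ... | nothing = refl

  closed-lookup : ∀ {τ} a K → Closed τ (a ∷ K) → ∀ k → τ (σ Γ (lookup (a ∷ K) k)) ≡ lookup (a ∷ K) (next k)
  closed-lookup a K (_ , s , refl) k = trans (seg-lookup a K s k) (sym (next-maybe (lookup (a ∷ K)) k))

  closed-tabulate : ∀ {τ m} (f : Fin (suc m) → HE n) → (∀ k → τ (σ Γ (f k)) ≡ f (next k)) → Closed τ (tabulate f)
  closed-tabulate f e = f zero , seg-tabulate f (λ k → trans (e k) (next-maybe f k)) , refl

  -- An Euler tour is the case I = ⊤, a cycle decomposition the case I = Fin (length cs).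
  record TrailCover (I : Set) : Set where
    field
      trails    : I → ClosedTrail Γ
    Position : Set
    Position = Σ I λ i → Fin (suc (len′ (trails i))) × Bool
    end : Position → HE n
    end (i , p) = endAt (trails i) p
    field
      injective : ∀ p q → end p ≡ end q → p ≡ q
      position  : ∀ h → ∃ λ p → end p ≡ h
      orthogonal : ∀ i → OrthTrail T (trails i)

    -- The Boolean `false` marks the departing end of step k and `true` its arriving end. A passage
    -- joins the arrival of one step to the departure of the next.
    opposite : Position → Position
    opposite (i , k , false) = i , prev k , true
    opposite (i , k , true)  = i , next k , false

    opposite-inv : ∀ p → opposite (opposite p) ≡ p
    opposite-inv (i , k , false) = cong (λ k → i , k , false) (next-prev k)
    opposite-inv (i , k , true)  = cong (λ k → i , k , true) (prev-next k)

    transition : HE n → HE n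
    transition h = end (opposite (proj₁ (position h)))

    transition-end : ∀ p → transition (end p) ≡ end (opposite p)
    transition-end p = cong (end ∘ opposite) (injective (proj₁ (position (end p))) p (proj₂ (position (end p))))

    vert-opposite : ∀ p → vert (end (opposite p)) ≡ vert (end p)
    vert-opposite (i , k , false) = trans (sym (step (trails i) (prev k))) (cong (vert ∘ d (trails i)) (next-prev k))
    vert-opposite (i , k , true)  = step (trails i) k

    opposite-≢ : ∀ p → end (opposite p) ≢ end p
    opposite-≢ (i , k , false) e = noBack (trails i) (prev k) (trans (cong (d (trails i)) (next-prev k)) (sym e))
    opposite-≢ (i , k , true)  e = noBack (trails i) k e

    opposite-orth : ∀ p → T̂ (end p) ≢ end (opposite p)
    opposite-orth (i , k , false) e = orthogonal i (prev k)
        (trans (cong idx (sym T̂-eq)) (cong (idx ∘ d (trails i)) (sym (next-prev k))))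
      where
      T̂-eq : d (trails i) k ≡ T̂ (σ Γ (d (trails i) (prev k)))
      T̂-eq = trans (sym (T̂-inv _)) (cong T̂ e)
    opposite-orth (i , k , true) e = orthogonal i k (cong idx e)

    transition-system : System transition
    transition-system = record
      { vp   = λ h → lift (λ p → trans (cong vert (transition-end p)) (vert-opposite p)) h
      ; inv  = λ h → lift (λ p → trans (cong transition (transition-end p))
                             (trans (transition-end (opposite p)) (cong end (opposite-inv p)))) h
      ; nfix = λ h → lift (λ p e → opposite-≢ p (trans (sym (transition-end p)) e)) h
      ; orth = λ h → lift (λ p e → opposite-orth p (trans e (transition-end p))) h
      }
      where
      lift : {Q : HE n → Set} → (∀ p → Q (end p)) → ∀ h → Q h
      lift {Q} f h = subst Q (proj₂ (position h)) (f (proj₁ (position h)))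

    transition-next : ∀ i k → transition (σ Γ (d (trails i) k)) ≡ d (trails i) (next k)
    transition-next i k = transition-end (i , k , true)

  -- The graph of the given Euler tour.

  module EulerTours {w : ClosedTrail Γ} (et : EulerTour w) (ow : OrthTrail T w) where

    cover : TrailCover ⊤
    cover = record
      { trails     = λ _ → w
      ; injective  = λ p q e → cong (tt ,_) (proj₁ et (proj₂ p) (proj₂ q) e)
      ; position   = λ h → (tt , proj₁ (proj₂ et h)) , proj₂ (proj₂ et h)
      ; orthogonal = λ _ → ow
      }
    open TrailCover cover using (transition; transition-system; transition-next)

    darts : List (HE n)
    darts = tabulate (d w)

    private
      d-inj : ∀ {i j} → d w i ≡ d w j → i ≡ j
      d-inj {i} {j} e = cong proj₁ (proj₁ et (i , false) (j , false) e)

      cnt-σ : ∀ k → H.cnt (σ Γ (d w k)) darts ≡ 0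
      cnt-σ k = H.cnt-tabulate-∉ (d w) λ j e → case proj₁ et (j , false) (k , true) e of λ ()

    tour : Tour transition darts
    tour = record
      { sys    = transition-system
      ; closed = closed-tabulate (d w) (transition-next tt)
      ; euler  = euler
      }
      where
      euler : ∀ h → H.cnt h darts + H.cnt (σ Γ h) darts ≡ 1
      euler h with proj₂ et h
      ... | (k , false) , refl = cong₂ _+_ (H.cnt-tabulate (d w) d-inj k) (cnt-σ k)
      ... | (k , true)  , refl = cong₂ _+_ (cnt-σ k)
              (trans (cong (λ h → H.cnt h darts) (σ-inv Γ (d w k))) (H.cnt-tabulate (d w) d-inj k))

    open Tour tour using (twice; par-τ; ∈⇒par; par⇒∈)
    open System transition-system

    -- The value is true when exactly one of h and `T̂ h` departs, that is at the white vertices;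
    -- hence the negation in `interlace`.
    monochromatic : HE n → Bool
    monochromatic h = H.par (T̂ h) darts xor H.par h darts

    monochromatic-T̂ : ∀ h → monochromatic (T̂ h) ≡ monochromatic h
    monochromatic-T̂ h = trans (cong (λ k → H.par k darts xor H.par (T̂ h) darts) (T̂-inv h)) (xor-comm (H.par h darts) _)

    monochromatic-τ : ∀ h → monochromatic (transition h) ≡ monochromatic h
    monochromatic-τ h = trans (cong₂ _xor_ (trans (cong (λ k → H.par k darts) (sym (comm h))) (par-τ (T̂ h))) (par-τ h))
      (solve 2 (λ x y → (con true :+ x) :+ (con true :+ y) := x :+ y) refl (H.par (T̂ h) darts) (H.par h darts))
      where open xor-∧-Solver

    -- Passing to the T-partner swaps the two summands and passing to the τ-partner negates both;
    -- these two moves reach all ends at the vertex.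
    monochromatic-vert : ∀ h h′ → vert h ≡ vert h′ → monochromatic h ≡ monochromatic h′
    monochromatic-vert h h′ e with exhaust h h′ e
    ... | inj₁ refl               = refl
    ... | inj₂ (inj₁ refl)        = sym (monochromatic-T̂ h)
    ... | inj₂ (inj₂ (inj₁ refl)) = sym (monochromatic-τ h)
    ... | inj₂ (inj₂ (inj₂ refl)) = sym (trans (monochromatic-T̂ (transition h)) (monochromatic-τ h))

    -- A computed graph that mediates between the existential conditions on G and the parities. The
    -- diagonal has to be masked, since `V.inter x x` is true for a vertex passed twice.
    interlace : BGraph n
    interlace = record
      { adj   = λ x y → not (V.eq x y) ∧ V.inter x y (wd darts)
      ; black = λ x → not (monochromatic (x , zero))
      }

    interlace-represents : Represents transition darts interlace
    interlace-represents = record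
      { tour     = tour
      ; adjacent = λ {x} {y} ne → cong (λ b → not b ∧ V.inter x y (wd darts)) (V.eq-false ne)
      ; loopless = λ x → cong (λ b → not b ∧ V.inter x x (wd darts)) (V.eq-true refl)
      ; colour   = λ h → trans (monochromatic-vert h (vert h , zero) refl) (sym (not-involutive _))
      }

    crossing-positions : ∀ {u v} → Crossing u v darts →
      ∃ λ i → ∃ λ j → ∃ λ k → ∃ λ l → i Fin.< j × j Fin.< k × k Fin.< l ×
        vert (d w i) ≡ u × vert (d w j) ≡ v × vert (d w k) ≡ u × vert (d w l) ≡ v
    crossing-positions cr with ⊆-lookups₄ (d w) (subst (_ ⊆_) (sym eqn)
        (++⁺ˡ P (refl ∷ ++⁺ˡ A (refl ∷ ++⁺ˡ B (refl ∷ ++⁺ˡ C (refl ∷ minimum Q))))))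
      where open Crossing cr
    ... | i , j , k , l , p , q , r , e₁ , e₂ , e₃ , e₄ = i , j , k , l , p , q , r ,
      trans (cong vert e₁) va , trans (cong vert e₂) vb , trans (cong vert e₃) va′ , trans (cong vert e₄) vb′
      where open Crossing cr

    adj⇒Interlace : ∀ {u v} → adj interlace u v ≡ true → Interlace w u v
    adj⇒Interlace {u} {v} e = [ interlaced ∘ crossing-positions , interlaced′ ∘ crossing-positions ]′
      (crossing interlace-represents e)
      where
      interlaced : _ → Interlace w u v
      interlaced (i , j , k , l , p , q , r , es) = i , j , k , l , p , q , r , inj₁ es
      interlaced′ : _ → Interlace w u v
      interlaced′ (i , j , k , l , p , q , r , es) = i , j , k , l , p , q , r , inj₂ es

    Interlace⇒adj : ∀ {u v} → u ≢ v → Interlace w u v → adj interlace u v ≡ true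
    Interlace⇒adj {u} {v} ne (i , j , k , l , p , q , r , cases) = trans
      (cong (λ b → not b ∧ V.inter u v (wd darts)) (V.eq-false ne))
      (V.inter-alternating ne (twice u) (twice v) ([ inj₁ ∘ word , inj₂ ∘ word ]′ cases))
      where
      word : ∀ {x y} → vert (d w i) ≡ x × vert (d w j) ≡ y × vert (d w k) ≡ x × vert (d w l) ≡ y →
        (x ∷ y ∷ x ∷ y ∷ []) ⊆ wd darts
      word {x} {y} (e₁ , e₂ , e₃ , e₄) = subst (_⊆ wd darts)
        (cong₂ _∷_ e₁ (cong₂ _∷_ e₂ (cong₂ _∷_ e₃ (cong (_∷ []) e₄)))) (map⁺ vert (lookups-⊆₄ (d w) p q r))

    entering : ∀ h → H.par h darts ≡ false → ∃ λ k → σ Γ (d w k) ≡ h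
    entering h e with proj₂ et h
    ... | (k , true)  , p = k , p
    ... | (k , false) , refl with trans (sym (∈⇒par (∈-tabulate⁺ {f = d w} k))) e
    ...   | ()

    two-entering : ∀ h → H.par h darts ≡ false → H.par (T̂ h) darts ≡ false → BlackIn T w (vert h)
    two-entering h e e′ with entering h e | entering (T̂ h) e′
    ... | a , p | b , q = a , b ,
      (λ { refl → T̂-nfix h (trans (sym q) p) }) , cong vert p , cong vert q ,
      trans (cong (pair T (vert h) ∘ idx) p) (cong idx (sym q))

    black⇒BlackIn : ∀ u → black interlace u ≡ true → BlackIn T w u
    black⇒BlackIn u e = by-parity _ _ refl refl
      where
      h : HE n
      h = u , zero
      by-parity : ∀ b c → H.par h darts ≡ b → H.par (T̂ h) darts ≡ c → BlackIn T w u
      by-parity false false p q = two-entering h p q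
      -- When both ends depart, their τ-partners both arrive, and by `comm` they are again paired by
      -- T.
      by-parity true  true  p q = subst (BlackIn T w) (vp h) (two-entering (transition h) (trans (par-τ h) (cong not p))
        (trans (cong (λ k → H.par k darts) (sym (comm h))) (trans (par-τ (T̂ h)) (cong not q))))
      by-parity true  false p q with trans (sym e) (cong not (cong₂ _xor_ q p))
      ... | ()
      by-parity false true  p q with trans (sym e) (cong not (cong₂ _xor_ q p))
      ... | ()

    BlackIn⇒black : ∀ u → BlackIn T w u → black interlace u ≡ true
    BlackIn⇒black u (a , b , _ , p , q , e) = cong not
      (trans (monochromatic-vert (u , zero) (σ Γ (d w a)) (sym p))
        (cong₂ _xor_ (trans (cong (λ k → H.par k darts) T̂-eq) (cong odd (cnt-σ b))) (cong odd (cnt-σ a))))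
      where
      T̂-eq : T̂ (σ Γ (d w a)) ≡ σ Γ (d w b)
      T̂-eq = cong₂ _,_ (trans p (sym q)) (trans (cong (λ v → pair T v (idx (σ Γ (d w a)))) p) e)

    isGw-represents : ∀ {G} → IsGw T w G → Represents transition darts G
    isGw-represents {G} (adj⇔ , black⇔) = record
      { tour     = tour
      ; adjacent = λ ne → trans (same-adj _ _) (Represents.adjacent interlace-represents ne)
      ; loopless = λ x → trans (same-adj x x) (Represents.loopless interlace-represents x)
      ; colour   = λ h → trans (Represents.colour interlace-represents h) (cong not (sym (same-black (vert h))))
      }
      where
      bool-ext : ∀ {a b} → (a ≡ true → b ≡ true) → (b ≡ true → a ≡ true) → a ≡ b
      bool-ext {true}  f g = sym (f refl)
      bool-ext {false} {true}  f g = g refl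
      bool-ext {false} {false} f g = refl
      adj-≢ : ∀ {x y} → adj interlace x y ≡ true → x ≢ y
      adj-≢ {x} e refl with trans (sym e) (Represents.loopless interlace-represents x)
      ... | ()
      same-adj : ∀ x y → adj G x y ≡ adj interlace x y
      same-adj x y = bool-ext
        (λ e → let ne , i = Equivalence.to (adj⇔ x y) e in Interlace⇒adj ne i)
        (λ e → Equivalence.from (adj⇔ x y) (adj-≢ e , adj⇒Interlace e))
      same-black : ∀ x → black G x ≡ black interlace x
      same-black x = bool-ext (BlackIn⇒black x ∘ Equivalence.to (black⇔ x)) (Equivalence.from (black⇔ x) ∘ black⇒BlackIn x)

  -- From a black anticlique to an orthogonal cycle decomposition.

  members : (Fin n → Bool) → List (Fin n)
  members S = filter (λ x → S x Bool.≟ true) (allFin n)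

  members-unique : ∀ S → Unique (members S)
  members-unique S = filter⁺ (λ x → S x Bool.≟ true) (allFin⁺ n)

  ∈-members⁺ : ∀ {S x} → S x ≡ true → x ∈ members S
  ∈-members⁺ {S} {x} e = ∈-filter⁺ (λ x → S x Bool.≟ true) (∈-allFin x) e

  ∈-members⁻ : ∀ {S x} → x ∈ members S → S x ≡ true
  ∈-members⁻ {S} i = proj₂ (∈-filter⁻ (λ x → S x Bool.≟ true) {xs = allFin n} i)

  -- A pointwise relation, so that it covers both `flip S τ` and an involution read off from a given
  -- decomposition.
  Switched : (Fin n → Bool) → (HE n → HE n) → (HE n → HE n) → Set
  Switched S τ τ′ = ∀ h → (S (vert h) ≡ true → τ′ h ≡ T̂ (τ h)) × (S (vert h) ≡ false → τ′ h ≡ τ h)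

  false≢true : ∀ {A : Set} {b : Bool} → b ≡ false → b ≡ true → A
  false≢true p q with trans (sym p) q
  ... | ()

  module _ {τ L G} (rep : Represents τ L G) where
    open Represents rep

    -- The vertex argument guarantees that the dart list is not empty.
    represents-parts : ∀ {τ′} S → Fin n → (∀ x → S x ≡ true → black G x ≡ true) →
      (∀ x y → S x ≡ true → S y ≡ true → x ≢ y → adj G x y ≡ false) → Switched S τ τ′ → Parts τ′ (members S) L
    represents-parts S v bl ind sw = decompose (members S) (members-unique S) record
      { sys       = sys
      ; closed    = closed
      ; nonempty  = λ { refl → case twice v of λ () }
      ; switched  = λ h i → proj₁ (sw h) (∈-members⁻ {S} i)
      ; unchanged = λ h ¬i → proj₂ (sw h) (¬-not (¬i ∘ ∈-members⁺ {S}))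
      ; mates     = λ a∈ b∈ e i → mates a∈ b∈ e (bl _ (∈-members⁻ {S} i))
      ; simple    = λ h → ≤-trans (m≤m+n _ _) (≤-reflexive (euler h))
      ; at-most-2 = λ z → ≤-reflexive (twice z)
      ; even      = λ {x} _ → cong odd (twice x)
      ; nested    = λ i j ne → trans (sym (adjacent ne)) (ind _ _ (∈-members⁻ {S} i) (∈-members⁻ {S} j) ne)
      }
      where
      mates : ∀ {a b} → a ∈ L → b ∈ L → vert a ≡ vert b → black G (vert a) ≡ true → a ≢ b → T̂ a ≡ b
      mates {a} {b} a∈ b∈ e bl ne = by-passage (only a∈ refl) (only b∈ (sym e))
        where
        p : Passages (vert a) L
        p = passages (vert a) L (twice (vert a))
        open Passages p using (only) renaming (a to a₁; b to a₂)
        by-passage : a ≡ a₁ ⊎ a ≡ a₂ → b ≡ a₁ ⊎ b ≡ a₂ → T̂ a ≡ b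
        by-passage (inj₁ p₁) (inj₁ q₁) = ⊥-elim (ne (trans p₁ (sym q₁)))
        by-passage (inj₁ p₁) (inj₂ q₂) = trans (cong T̂ p₁) (trans (black-passages p bl) (sym q₂))
        by-passage (inj₂ p₂) (inj₁ q₁) = trans (cong T̂ (trans p₂ (sym (black-passages p bl)))) (trans (T̂-inv a₁) (sym q₁))
        by-passage (inj₂ p₂) (inj₂ q₂) = ⊥-elim (ne (trans p₂ (sym q₂)))

  -- Traversals of the edge containing h, in either direction.
  visit : List (HE n) → HE n → ℕ
  visit L h = H.cnt h L + H.cnt (σ Γ h) L

  visit-++ : ∀ K L h → visit (K ++ L) h ≡ visit K h + visit L h
  visit-++ K L h = trans (cong₂ _+_ (H.cnt-++ h K L) (H.cnt-++ (σ Γ h) K L))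
    (solve 4 (λ a b c d → (a :+ b) :+ (c :+ d) := (a :+ c) :+ (b :+ d)) refl
      (H.cnt h K) (H.cnt h L) (H.cnt (σ Γ h) K) (H.cnt (σ Γ h) L))
    where open ℕ-Solver.+-*-Solver

  ∈⇒1≤cnt : ∀ {h : HE n} {L} → h ∈ L → 1 ≤ H.cnt h L
  ∈⇒1≤cnt i with H.∈⇒cnt>0 i
  ... | m , e = ≤-trans (s≤s z≤n) (≤-reflexive (sym e))

  dart-visit : ∀ {h : HE n} {L} → h ∈ L → 1 ≤ visit L h
  dart-visit {h} {L} i = ≤-trans (∈⇒1≤cnt i) (m≤m+n (H.cnt h L) _)

  dart-visit-σ : ∀ {h : HE n} {L} → h ∈ L → 1 ≤ visit L (σ Γ h)
  dart-visit-σ {h} {L} i = ≤-trans (∈⇒1≤cnt i)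
    (≤-trans (≤-reflexive (cong (λ k → H.cnt k L) (sym (σ-inv Γ h)))) (m≤n+m _ (H.cnt (σ Γ h) L)))

  module Cycles {τ} (sys : System τ) where
    open System sys

    record IsCycle (K : List (HE n)) : Set where
      field
        closed   : Closed τ K
        nonempty : K ≢ []
        once     : ∀ z → V.cnt z (wd K) ≤ 1

    lookup-distinct : ∀ K → (∀ z → V.cnt z (wd K) ≤ 1) → ∀ i j → vert (lookup K i) ≡ vert (lookup K j) → i ≡ j
    lookup-distinct (a ∷ K) le zero    zero    e = refl
    lookup-distinct (a ∷ K) le zero    (suc j) e = ⊥-elim (V.cnt≡0⇒∉ {x = vert a} {wd K}
      (n≤0⇒n≡0 (s≤s⁻¹ (≤-trans (≤-reflexive (sym (V.cnt-here (wd K) refl))) (le (vert a)))))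
      (subst (_∈ wd K) (sym e) (∈-map⁺ vert (∈-lookup j))))
    lookup-distinct (a ∷ K) le (suc i) zero    e = ⊥-elim (V.cnt≡0⇒∉ {x = vert a} {wd K}
      (n≤0⇒n≡0 (s≤s⁻¹ (≤-trans (≤-reflexive (sym (V.cnt-here (wd K) refl))) (le (vert a)))))
      (subst (_∈ wd K) e (∈-map⁺ vert (∈-lookup i))))
    lookup-distinct (a ∷ K) le (suc i) (suc j) e =
      cong suc (lookup-distinct K (λ z → ≤-trans (m≤n+m _ _) (le z)) i j e)

    cycle : ∀ K → IsCycle K → Cycle Γ
    cycle []      ic = ⊥-elim (IsCycle.nonempty ic refl)
    cycle (a ∷ K) ic = record
      { trail = record
        { len′   = length K
        ; d      = lookup (a ∷ K)
        ; step   = λ k → trans (cong vert (sym (succ k))) (vp _)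
        ; noBack = λ k e → nfix _ (trans (succ k) e)
        }
      ; distinct = lookup-distinct (a ∷ K) (IsCycle.once ic)
      }
      where
      succ : ∀ k → τ (σ Γ (lookup (a ∷ K) k)) ≡ lookup (a ∷ K) (next k)
      succ = closed-lookup a K (IsCycle.closed ic)

    cycle-orth : ∀ K (ic : IsCycle K) → OrthTrail T (trail (cycle K ic))
    cycle-orth []      ic k e = IsCycle.nonempty ic refl
    cycle-orth (a ∷ K) ic k e = orth (σ Γ (lookup (a ∷ K) k)) (trans (cong₂ _,_ (sym (step (trail (cycle (a ∷ K) ic)) k)) e)
      (sym (closed-lookup a K (IsCycle.closed ic) k)))

    cycle-visit : ∀ K (ic : IsCycle K) p → 1 ≤ visit K (endAt (trail (cycle K ic)) p)
    cycle-visit []      ic p = ⊥-elim (IsCycle.nonempty ic refl)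
    cycle-visit (a ∷ K) ic (k , false) = dart-visit (∈-lookup {xs = a ∷ K} k)
    cycle-visit (a ∷ K) ic (k , true)  = dart-visit-σ (∈-lookup {xs = a ∷ K} k)

    cycle-injective : ∀ K (ic : IsCycle K) → (∀ h → visit K h ≤ 1) →
      ∀ p q → endAt (trail (cycle K ic)) p ≡ endAt (trail (cycle K ic)) q → p ≡ q
    cycle-injective []      ic le p q e = ⊥-elim (IsCycle.nonempty ic refl)
    cycle-injective (a ∷ K) ic le p q e = by-side p q e
      where
      both-ends : ∀ i j → lookup (a ∷ K) i ≢ σ Γ (lookup (a ∷ K) j)
      both-ends i j e = <-irrefl refl (≤-trans (+-mono-≤ (∈⇒1≤cnt (∈-lookup {xs = a ∷ K} j))
        (∈⇒1≤cnt (subst (_∈ a ∷ K) e (∈-lookup {xs = a ∷ K} i)))) (le (lookup (a ∷ K) j)))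
      by-side : ∀ p q → endAt (trail (cycle (a ∷ K) ic)) p ≡ endAt (trail (cycle (a ∷ K) ic)) q → p ≡ q
      by-side (i , false) (j , false) e = cong (_, false) (lookup-distinct (a ∷ K) (IsCycle.once ic) i j (cong vert e))
      by-side (i , true)  (j , true)  e = cong (_, true)
          (lookup-distinct (a ∷ K) (IsCycle.once ic) i j (cong vert (σ-inj e)))
      by-side (i , false) (j , true)  e = ⊥-elim (both-ends i j e)
      by-side (i , true)  (j , false) e = ⊥-elim (both-ends j i (sym e))

    cycle-dart : ∀ K (ic : IsCycle K) {h} → h ∈ K → ∃ λ k → d (trail (cycle K ic)) k ≡ h
    cycle-dart (a ∷ K) ic i = Any.index i , sym (lookup-index i)

    cycles : ∀ Ks → (∀ {K} → K ∈ Ks → IsCycle K) → List (Cycle Γ)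
    cycles []       ics = []
    cycles (K ∷ Ks) ics = cycle K (ics (here refl)) ∷ cycles Ks (ics ∘ there)

    cycles-orth : ∀ Ks (ics : ∀ {K} → K ∈ Ks → IsCycle K) → OrthDecomp T (cycles Ks ics)
    cycles-orth (K ∷ Ks) ics zero    = cycle-orth K (ics (here refl))
    cycles-orth (K ∷ Ks) ics (suc i) = cycles-orth Ks (ics ∘ there) i

    cycles-visit : ∀ Ks (ics : ∀ {K} → K ∈ Ks → IsCycle K) p → 1 ≤ visit (concat Ks) (endAtD (cycles Ks ics) p)
    cycles-visit (K ∷ Ks) ics (zero , p) = ≤-trans (cycle-visit K (ics (here refl)) p)
      (≤-trans (m≤m+n _ (visit (concat Ks) h)) (≤-reflexive (sym (visit-++ K (concat Ks) h))))
      where h = endAt (trail (cycle K (ics (here refl)))) p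
    cycles-visit (K ∷ Ks) ics (suc i , p) = ≤-trans (cycles-visit Ks (ics ∘ there) (i , p))
      (≤-trans (m≤n+m _ (visit K h)) (≤-reflexive (sym (visit-++ K (concat Ks) h))))
      where h = endAtD (cycles Ks (ics ∘ there)) (i , p)

    cycles-injective : ∀ Ks (ics : ∀ {K} → K ∈ Ks → IsCycle K) → (∀ h → visit (concat Ks) h ≤ 1) →
      ∀ p q → endAtD (cycles Ks ics) p ≡ endAtD (cycles Ks ics) q → p ≡ q
    cycles-injective (K ∷ Ks) ics le = by-index
      where
      le′ : ∀ h → visit K h + visit (concat Ks) h ≤ 1
      le′ h = ≤-trans (≤-reflexive (sym (visit-++ K (concat Ks) h))) (le h)
      apart : ∀ p q → endAt (trail (cycle K (ics (here refl)))) p ≢ endAtD (cycles Ks (ics ∘ there)) q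
      apart p q e = <-irrefl refl (≤-trans (+-mono-≤ (cycle-visit K (ics (here refl)) p)
        (≤-trans (cycles-visit Ks (ics ∘ there) q) (≤-reflexive (cong (visit (concat Ks)) (sym e))))) (le′ _))
      by-index : ∀ p q → endAtD (cycles (K ∷ Ks) ics) p ≡ endAtD (cycles (K ∷ Ks) ics) q → p ≡ q
      by-index (zero , p) (zero , q) e = cong (zero ,_)
        (cycle-injective K (ics (here refl)) (λ h → ≤-trans (m≤m+n _ _) (le′ h)) p q e)
      by-index (zero , p)  (suc j , q) e = ⊥-elim (apart p (j , q) e)
      by-index (suc i , p) (zero , q)  e = ⊥-elim (apart q (i , p) (sym e))
      by-index (suc i , p) (suc j , q) e
        with cycles-injective Ks (ics ∘ there) (λ h → ≤-trans (m≤n+m _ (visit K h)) (le′ h)) (i , p) (j , q) e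
      ... | refl = refl

    cycles-dart : ∀ Ks (ics : ∀ {K} → K ∈ Ks → IsCycle K) {h} → h ∈ concat Ks →
      ∃ λ i → ∃ λ k → d (trail (lookup (cycles Ks ics) i)) k ≡ h
    cycles-dart (K ∷ Ks) ics i with ∈-++⁻ K i
    ... | inj₁ j = zero , cycle-dart K (ics (here refl)) j
    ... | inj₂ j with cycles-dart Ks (ics ∘ there) j
    ...   | i′ , k , e = suc i′ , k , e

    cycles-decomposition : ∀ Ks (ics : ∀ {K} → K ∈ Ks → IsCycle K) → (∀ h → visit (concat Ks) h ≡ 1) →
      HasOrthCycleDecomposition Γ T
    cycles-decomposition Ks ics e = cycles Ks ics ,
      (cycles-injective Ks ics (≤-reflexive ∘ e) , surjective) , cycles-orth Ks ics
      where
      surjective : ∀ h → ∃ λ p → endAtD (cycles Ks ics) p ≡ h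
      surjective h with H.cnt h (concat Ks) in c | e h
      ... | suc m | _ with cycles-dart Ks ics (H.cnt>0⇒∈ (concat Ks) c)
      ...   | i , k , p = (i , k , false) , p
      -- No trail departs along h, so the single traversal of its edge departs along `σ Γ h` and
      -- arrives at h.
      surjective h | zero | e′ with cycles-dart Ks ics (H.cnt>0⇒∈ (concat Ks) e′)
      ...   | i , k , p = (i , k , true) , trans (cong (σ Γ) p) (σ-inv Γ h)

  anticlique⇒decomposition : ∀ {τ L G S} → Fin n → Represents τ L G → BlackAnticlique G S → HasOrthCycleDecomposition Γ T
  anticlique⇒decomposition {τ} {L} {G} {S} v rep (bl , ind , dom) =
    Cycles.cycles-decomposition sys′ parts isCycle
      (λ h → trans (cong₂ _+_ (cnt-ends h) (cnt-ends (σ Γ h))) (euler h))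
    where
    open Represents rep using (sys; euler; adjacent; adj-sym; twice)
    sys′ : System (flip S τ)
    sys′ = flip-system S sys
    open Parts (represents-parts rep S v bl ind (λ h → flip-true {S} sys {h} , flip-false {S} sys {h}))
    isCycle : ∀ {K} → K ∈ parts → Cycles.IsCycle sys′ K
    isCycle {K} i = record { closed = closed i ; nonempty = nonempty i ; once = λ z → once z _ refl }
      where
      not-twice : ∀ z → V.cnt z (wd K) ≢ 2
      not-twice z e with separated i e
      ... | z∉ , noi with dom z (¬-not (z∉ ∘ ∈-members⁺ {S}))
      ...   | x , Sx , zx = false≢true (noi (∈-members⁺ {S} Sx)) (trans (sym (adjacent x≢z)) (trans (adj-sym x z) zx))
        where
        x≢z : x ≢ z
        x≢z refl = z∉ (∈-members⁺ {S} Sx)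
      once : ∀ z m → V.cnt z (wd K) ≡ m → V.cnt z (wd K) ≤ 1
      once z 0 e = ≤-trans (≤-reflexive e) z≤n
      once z 1 e = ≤-reflexive e
      once z 2 e = ⊥-elim (not-twice z e)
      once z (suc (suc (suc m))) e with ≤-trans (≤-reflexive (sym e)) (≤-trans (cnt-part z parts i) (≤-reflexive (trans (cnt-verts z) (twice z))))
      ... | s≤s (s≤s ())

  -- Cycle decompositions, and the search for an anticlique in the parity class.

  module FromDecomposition (cs : List (Cycle Γ)) (dec : IsCycleDecomposition cs) (orth-cs : OrthDecomp T cs) where

    cover : TrailCover (Fin (length cs))
    cover = record
      { trails     = λ i → trail (lookup cs i)
      ; injective  = proj₁ dec
      ; position   = proj₂ dec
      ; orthogonal = orth-cs
      }
    open TrailCover cover public using (end; position; transition; transition-system; transition-end; opposite)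

    along-σ : ∀ i k b → ∃ λ k′ → transition (σ Γ (end (i , k , b))) ≡ end (i , k′ , b)
    along-σ i k false = next k , transition-end (i , k , true)
    along-σ i k true  = prev k , trans (cong transition (σ-inv Γ _)) (transition-end (i , k , false))

    -- Following the transitions of the decomposition never leaves a trail and never turns round on
    -- it. The Boolean b is the direction, as the segment may run against the trail.
    same-trail : ∀ a A {c} i k b → Seg transition (a ∷ A) c → end (i , k , b) ≡ a → ∃ λ k′ → end (i , k′ , b) ≡ c
    same-trail a []       i k b (p , _) refl with along-σ i k b
    ... | k′ , e = k′ , trans (sym e) p
    same-trail a (a′ ∷ A) i k b (p , s) refl with along-σ i k b
    ... | k′ , e = same-trail a′ A i k′ b s (trans (sym e) p)

    trail-distinct : ∀ i k k′ b → vert (end (i , k , b)) ≡ vert (end (i , k′ , b)) → k ≡ k′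
    trail-distinct i k k′ false e = distinct (lookup cs i) k k′ e
    trail-distinct i k k′ true  e = trans (sym (prev-next k)) (trans (cong prev (distinct (lookup cs i) (next k) (next k′)
      (trans (step t k) (trans e (sym (step t k′)))))) (prev-next k′))
      where t = trail (lookup cs i)

    -- Two departures from z would lie on the same cycle with the same direction. Its vertices are
    -- distinct, so they would be one dart occurring twice.
    not-twice : ∀ {K z} → Closed transition K → (∀ h → H.cnt h K ≤ 1) → V.cnt z (wd K) ≢ 2
    not-twice {K} {z} cl le e = repeated (passages z K e)
      where
      repeated : Passages z K → ⊥
      repeated p = by-position (position a)
        where
        open Passages p
        by-position : (∃ λ q → end q ≡ a) → ⊥
        by-position ((i , k , b′) , q) with same-trail a A i k b′ (proj₁ (proj₂ (closed-passages P a A (subst (Closed transition) eqn cl)))) q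
        ... | k′ , q′ = passages-≢ p (le a) (trans (sym q) (trans (cong (λ k → end (i , k , b′))
                (trail-distinct i k k′ b′ (trans (cong vert q) (trans va (sym (trans (cong vert q′) vb)))))) q′))

  -- Every graph of the parity class comes from some orthogonal Euler tour, so an anticlique may be
  -- used wherever in the class it occurs.
  word-represents : ∀ {τ L G s} → Represents τ L G → W G s → ∃ λ τ′ → ∃ λ L′ → Represents τ′ L′ (apply G s)
  word-represents rep empty = _ , _ , rep
  word-represents {G = G} rep (white {s} {u} ws wh) with word-represents rep ws
  ... | _ , _ , rep′ with white-move rep′ wh
  ...   | L″ , rep″ = _ , L″ , subst (Represents _ L″) (sym (foldl-++ lc G s (u ∷ []))) rep″
  word-represents {G = G} rep (pivotuvu {s} {u} {v} ws uv bu bv) with word-represents rep ws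
  ... | _ , _ , rep′ with pivot-move rep′ uv bu bv
  ...   | (L″ , rep″) , _ = _ , L″ , subst (Represents _ L″) (sym (foldl-++ lc G s (u ∷ v ∷ u ∷ []))) rep″
  word-represents {G = G} rep (pivotvuv {s} {u} {v} ws uv bu bv) with word-represents rep ws
  ... | _ , _ , rep′ with pivot-move rep′ uv bu bv
  ...   | _ , (L″ , rep″) = _ , L″ , subst (Represents _ L″) (sym (foldl-++ lc G s (v ∷ u ∷ v ∷ []))) rep″

  module _ {τ τ′} (sys : System τ) (sys′ : System τ′) where
    private
      module S = System sys
      module S′ = System sys′

    -- Of the three pairings at a vertex the one of T is excluded by orthogonality.
    same-or-switched : ∀ h → τ′ h ≡ τ h ⊎ τ′ h ≡ T̂ (τ h)
    same-or-switched h with S.exhaust h (τ′ h) (sym (S′.vp h))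
    ... | inj₁ e        = ⊥-elim (S′.nfix h e)
    ... | inj₂ (inj₁ e) = ⊥-elim (S′.orth h (sym e))
    ... | inj₂ (inj₂ e) = e

    agree-vert : ∀ h h′ → vert h ≡ vert h′ → τ′ h ≡ τ h → τ′ h′ ≡ τ h′
    agree-vert h h′ e a with S.exhaust h h′ e
    ... | inj₁ refl               = a
    ... | inj₂ (inj₁ refl)        = trans (S′.comm h) (trans (cong T̂ a) (sym (S.comm h)))
    ... | inj₂ (inj₂ (inj₁ refl)) = trans (cong τ′ (sym a)) (trans (S′.inv h) (sym (S.inv h)))
    ... | inj₂ (inj₂ (inj₂ refl)) = trans (S′.comm (τ h)) (trans
            (cong T̂ (trans (cong τ′ (sym a)) (trans (S′.inv h) (sym (S.inv h))))) (sym (S.comm (τ h))))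

    -- Testing a single end suffices: by `agree-vert` agreement at one end spreads to the whole
    -- vertex.
    difference : Fin n → Bool
    difference x = not (H.eq (τ′ (x , zero)) (τ (x , zero)))

    difference-switched : Switched difference τ τ′
    difference-switched h = differ _ refl , agree _ refl
      where
      h₀ : HE n
      h₀ = vert h , zero
      differ : ∀ b → H.eq (τ′ h₀) (τ h₀) ≡ b → not b ≡ true → τ′ h ≡ T̂ (τ h)
      differ false e _ with same-or-switched h
      ... | inj₁ p = ⊥-elim (H.eq⇒≢ e (agree-vert h h₀ refl p))
      ... | inj₂ p = p
      agree : ∀ b → H.eq (τ′ h₀) (τ h₀) ≡ b → not b ≡ false → τ′ h ≡ τ h
      agree true e _ = agree-vert h₀ h refl (H.eq⇒≡ e)

  _∖_ : (Fin n → Bool) → (Fin n → Bool) → Fin n → Bool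
  (S ∖ R) x = S x ∧ not (R x)

  switched-∖ : ∀ {S R τ τ′} → System τ → (∀ x → R x ≡ true → S x ≡ true) → Switched S τ τ′ → Switched (S ∖ R) (flip R τ) τ′
  switched-∖ {S} {R} {τ} {τ′} sys R⊆S sw h = remaining (R (vert h)) refl , removed (R (vert h)) refl
    where
    remaining : ∀ r → R (vert h) ≡ r → S (vert h) ∧ not r ≡ true → τ′ h ≡ T̂ (flip R τ h)
    remaining false e p = trans (proj₁ (sw h) (trans (sym (∧-identityʳ _)) p)) (cong T̂ (sym (flip-false {R} sys e)))
    remaining true  e p = false≢true (∧-zeroʳ (S (vert h))) p
    removed : ∀ r → R (vert h) ≡ r → S (vert h) ∧ not r ≡ false → τ′ h ≡ flip R τ h
    removed true  e p = trans (proj₁ (sw h) (R⊆S _ e)) (sym (flip-true {R} sys e))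
    removed false e p = trans (proj₂ (sw h) (trans (sym (∧-identityʳ _)) p)) (sym (flip-false {R} sys e))

  size : (Fin n → Bool) → List (Fin n) → ℕ
  size S []       = 0
  size S (x ∷ xs) = b2n (S x) + size S xs

  b2n-∧-not : ∀ a b → b2n (a ∧ not b) ≤ b2n a
  b2n-∧-not false b     = z≤n
  b2n-∧-not true  false = ≤-refl
  b2n-∧-not true  true  = z≤n

  size-∖≤ : ∀ S R xs → size (S ∖ R) xs ≤ size S xs
  size-∖≤ S R []       = z≤n
  size-∖≤ S R (x ∷ xs) = +-mono-≤ (b2n-∧-not (S x) (R x)) (size-∖≤ S R xs)

  size-∖< : ∀ S R {x xs} → x ∈ xs → S x ≡ true → R x ≡ true → size (S ∖ R) xs < size S xs
  size-∖< S R {x} {_ ∷ xs} (here refl) s r rewrite s | r = s≤s (size-∖≤ S R xs)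
  size-∖< S R {x} {y ∷ xs} (there i)   s r = +-mono-≤-< (b2n-∧-not (S y) (R y)) (size-∖< S R i s r)

  module _ (cs : List (Cycle Γ)) (dec : IsCycleDecomposition cs) (orth-cs : OrthDecomp T cs) where
    open FromDecomposition cs dec orth-cs

    -- The number m strictly bounds the size of the set where the current tour still differs from
    -- the decomposition, and it is the recursion argument. Whites and adjacent pairs are looked for
    -- afresh each time, since a step changes the graph on the rest of S.
    reach-anticlique : ∀ {G} m S {s τ L} → size S (allFin n) < m → W G s → Represents τ L (apply G s) →
      Switched S τ transition → ∃ λ s′ → W G s′ × ∃ (BlackAnticlique (apply G s′))
    reach-anticlique {G} (suc m) S {s} {τ} {L} (s≤s le) ws rep sw = whites
        (any? λ x → (S x Bool.≟ true) ×-dec (black G′ x Bool.≟ false))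
      where
      open Represents rep
      G′ : BGraph n
      G′ = apply G s

      Goal : Set
      Goal = ∃ λ s′ → W G s′ × ∃ (BlackAnticlique (apply G s′))

      continue : ∀ R t {L′ x} → (∀ x → R x ≡ true → S x ≡ true) → S x ≡ true → R x ≡ true → W G (s ++ t) →
        Represents (flip R τ) L′ (apply G′ t) → Goal
      continue R t {L′} {x} R⊆S Sx Rx ws′ rep′ = reach-anticlique m (S ∖ R)
        (≤-trans (size-∖< S R (∈-allFin x) Sx Rx) le) ws′ (subst (Represents _ L′) (sym (foldl-++ lc G s t)) rep′)
        (switched-∖ sys R⊆S sw)

      anticlique : (∀ x → S x ≡ true → black G′ x ≡ true) →
        (∀ x y → S x ≡ true → S y ≡ true → x ≢ y → adj G′ x y ≡ false) → BlackAnticlique G′ S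
      anticlique bl ind = bl , ind , dominated
        where
        -- If no vertex of S were adjacent to z, both passages of z would stay on one closed trail
        -- of the switched tour. That trail follows the transitions of the decomposition, whose
        -- cycles pass no vertex twice.
        dominated : ∀ z → S z ≡ false → ∃ λ x → S x ≡ true × adj G′ z x ≡ true
        dominated z Sz with any? (λ x → (S x Bool.≟ true) ×-dec (adj G′ z x Bool.≟ true))
        ... | yes p = p
        ... | no ¬p = ⊥-elim (contradicts (together (twice z) (false≢true Sz ∘ ∈-members⁻ {S}) noi))
          where
          open Parts (represents-parts rep S z bl ind sw) using (parts; cnt-ends; together) renaming
              (closed to parts-closed)
          noi : ∀ {x} → x ∈ members S → V.inter x z (wd L) ≡ false
          noi {x} i = trans (sym (adjacent x≢z)) (¬-not λ e → ¬p (x , ∈-members⁻ {S} i , trans (adj-sym z x) e))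
            where
            x≢z : x ≢ z
            x≢z refl = false≢true Sz (∈-members⁻ {S} i)
          contradicts : (∃ λ K → K ∈ parts × V.cnt z (wd K) ≡ 2) → ⊥
          contradicts (K , i , e) = not-twice (parts-closed i) (λ h → ≤-trans (H.cnt-concat h parts i)
            (≤-trans (≤-reflexive (cnt-ends h)) (≤-trans (m≤m+n _ _) (≤-reflexive (euler h))))) e

      pairs : (∀ x → S x ≡ true → black G′ x ≡ true) →
        Dec (∃ λ u → ∃ λ v → S u ≡ true × S v ≡ true × adj G′ u v ≡ true) → Goal
      pairs bl (no ¬p) = s , ws , S , anticlique bl λ x y Sx Sy _ → ¬-not λ e → ¬p (x , y , Sx , Sy , e)
      pairs bl (yes (u , v , Su , Sv , uv)) =
        continue (both u v) (u ∷ v ∷ u ∷ []) both⊆S Su (cong (_∨ V.eq v u) (V.eq-true refl))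
          (pivotuvu ws uv (bl u Su) (bl v Sv)) (proj₂ (proj₁ (pivot-move rep uv (bl u Su) (bl v Sv))))
        where
        both⊆S : ∀ x → both u v x ≡ true → S x ≡ true
        both⊆S x e with u Fin.≟ x | v Fin.≟ x
        ... | yes refl | _        = Su
        ... | no _     | yes refl = Sv

      whites : Dec (∃ λ x → S x ≡ true × black G′ x ≡ false) → Goal
      whites (yes (u , Su , wh)) = continue (V.eq u) (u ∷ []) (λ x e → trans (cong S (sym (V.eq⇒≡ e))) Su) Su
          (V.eq-true refl)
        (white ws wh) (proj₂ (white-move rep wh))
      whites (no ¬p) = pairs (λ x Sx → ¬-not λ e → ¬p (x , Sx , e))
        (any? λ u → any? λ v → (S u Bool.≟ true) ×-dec (S v Bool.≟ true) ×-dec (adj G′ u v Bool.≟ true))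

theorem2p5p18 : ∀ {n : ℕ} (Γ : Graph4 n) → Connected Γ → (T : TransSys n) →
    (w : ClosedTrail Γ) → EulerTour w → OrthTrail T w →
    (G : BGraph n) → IsGw T w G →
    (¬ HasOrthCycleDecomposition Γ T) ⇔ Pure G
theorem2p5p18 {n} Γ _ T w et ow G gw = mk⇔ pure none
  where
  open Tours Γ T
  open EulerTours et ow

  rep : Represents _ darts G
  rep = isGw-represents gw

  pure : ¬ HasOrthCycleDecomposition Γ T → Pure G
  pure ¬dec s ws (S , anticlique) with word-represents rep ws
  -- A closed trail has at least one step, which supplies the required vertex.
  ... | _ , _ , rep′ = ¬dec (anticlique⇒decomposition (vert (d w zero)) rep′ anticlique)

  none : Pure G → ¬ HasOrthCycleDecomposition Γ T
  none pure-G (cs , dec , orth) =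
    let sys            = TrailCover.transition-system cover
        sys′           = FromDecomposition.transition-system cs dec orth
        s , ws , S , a = reach-anticlique cs dec orth _ (difference sys sys′) ≤-refl empty rep
            (difference-switched sys sys′)
    in pure-G s ws (S , a)
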